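{- Let $\phi=\frac{1+\sqrt5}{2}$. For the problem of scheduling with uncertain processing times on a single machine with the objective of minimizing the total completion time, the algorithm $(\alpha,\beta)$-PCP with $\alpha=\phi$ and $\beta=\frac{\phi+\sqrt{5\phi+1}}{2}$ has competitive ratio at most $\frac{\phi+\sqrt{5\phi+1}}{2}\le 2.316513$. Moreover, this choice of $\alpha$ and $\beta$ is optimal for the expression $$\max\left\{\alpha\left(1+\tfrac1\beta\right),\ 1+\tfrac1\alpha+\tfrac1\beta+\tfrac1{\alpha\beta},\ \beta,\ 2,\ 1+\tfrac2\alpha\right\},$$ i.e. it minimizes this expression over all choices of the parameters $\alpha,\beta\ge1$.
   Context: Problem. There are $n$ jobs, all available at time $0$. Job $j$ has a testing time $t_j\ge 0$, an upper limit $u_j\ge 0$, and a real processing time $p_j\in[0,u_j]$. A job may be executed untested, which takes $u_j$ time units, or it may be tested (taking $t_j$ time units) and later executed in $p_j$ time units; other tasks may run between the test and the execution. A single machine runs one task at a time. The completion time of a job is the time at which its execution (or execution-untested) ends, and the cost of a schedule is the sum of the completion times of all jobs. An online algorithm knows all $t_j,u_j$ from the start, but learns $p_j$ only when the test of $j$ is finished. $\mathrm{OPT}$ knows all $p_j$ in advance (but must still test $j$ in order to run it in time $p_j$), and its cost is the minimum cost of any schedule. The competitive ratio of an online algorithm $A$ is the smallest $c$ such that $\mathrm{cost}(A)\le c\cdot \mathrm{cost}(\mathrm{OPT})$ on all instances. Algorithm $(\alpha,\beta)$-PCP (Prioritizing-Certain-Processing-time). Maintain a priority queue of tasks, smaller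 weight meaning higher priority (ties broken arbitrarily). Initially, for each job $j$: if $u_j\ge\alpha t_j$, insert a testing task of weight $\beta t_j$; otherwise insert an execution-untested task of weight $u_j$. While the queue is nonempty, extract a task of smallest weight and run it; if it was the testing task of job $j$, then after the test insert an execution task for $j$ with weight $t_j+p_j$ (running this execution task takes $p_j$ time). -}

module Defs where

open import Data.Nat as ℕ using (ℕ; zero; suc)
import Data.Nat.Properties as ℕ
import Data.Integer as ℤ
import Data.Integer.Properties as ℤ
open import Data.Rational as ℚ using (ℚ; 0ℚ; 1ℚ; ½)
import Data.Rational.Properties as ℚ
import Data.Rational.Unnormalised as ℚᵘ
import Data.Rational.Unnormalised.Properties as ℚᵘ
open import Data.Rational.Solver using (module +-*-Solver)
open import Data.Fin using (Fin; _≟_)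
open import Data.List using (List; []; _∷_; _++_; allFin)
open import Data.List.Relation.Unary.All using (All)
open import Data.List.Relation.Binary.Pointwise using (Pointwise)
open import Data.List.Relation.Binary.Permutation.Propositional using (_↭_)
open import Data.Product using (∃-syntax; _×_; _,_; proj₁; proj₂)
open import Data.Sum using (_⊎_; inj₁; inj₂)
open import Relation.Nullary using (¬_; yes; no; contradiction)
open import Relation.Binary.PropositionalEquality using (_≡_; refl; sym; trans; cong; subst)

open +-*-Solver using (solve; _:=_; _:+_; _:*_; :-_; con)

module Rational where

  open import Data.Rational using (_+_; _*_; _-_; -_; _≤_; _<_; _⊔_; ∣_∣)

  reciprocal : ℚ → ℚ
  reciprocal q with q ℚ.≟ 0ℚ
  ... | yes _  = 0ℚ
  ... | no q≢0 = (ℚ.1/ q) ⦃ ℚ.≢-nonZero q≢0 ⦄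

  -- Each bisection step halves the width w of an interval [s , s + w) containing √q.
  bisect : ℚ → ℕ → ℚ × ℚ
  bisect q zero    = 0ℚ , 1ℚ + q
  bisect q (suc k) with bisect q k
  ... | s , w with (s + ½ * w) * (s + ½ * w) ℚ.≤? q
  ...   | yes _ = s + ½ * w , ½ * w
  ...   | no  _ = s , ½ * w

  abstract

    ≤-respˡ : ∀ {p p' q} → p ≡ p' → p ≤ q → p' ≤ q
    ≤-respˡ refl p≤q = p≤q

    ≤-respʳ : ∀ {p q q'} → q ≡ q' → p ≤ q → p ≤ q'
    ≤-respʳ refl p≤q = p≤q

    ≤-resp : ∀ {p p' q q'} → p ≡ p' → q ≡ q' → p ≤ q → p' ≤ q'
    ≤-resp refl refl p≤q = p≤q

    <-resp : ∀ {p p' q q'} → p ≡ p' → q ≡ q' → p < q → p' < q'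
    <-resp refl refl p<q = p<q

    *-monoˡ : ∀ {r p q} → 0ℚ ≤ r → p ≤ q → r * p ≤ r * q
    *-monoˡ {r} 0≤r = ℚ.*-monoˡ-≤-nonNeg r ⦃ ℚ.nonNegative 0≤r ⦄

    *-monoʳ : ∀ {r p q} → 0ℚ ≤ r → p ≤ q → p * r ≤ q * r
    *-monoʳ {r} 0≤r = ℚ.*-monoʳ-≤-nonNeg r ⦃ ℚ.nonNegative 0≤r ⦄

    *-mono : ∀ {p q r s} → 0ℚ ≤ p → 0ℚ ≤ s → p ≤ q → r ≤ s → p * r ≤ q * s
    *-mono {p} {q} {r} {s} 0≤p 0≤s p≤q r≤s = ℚ.≤-trans (*-monoˡ 0≤p r≤s) (*-monoʳ {s} 0≤s p≤q)

    *-nonNeg : ∀ {p q} → 0ℚ ≤ p → 0ℚ ≤ q → 0ℚ ≤ p * q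
    *-nonNeg {p} {q} 0≤p 0≤q = ≤-respˡ (ℚ.*-zeroʳ p) (*-monoˡ {p} 0≤p 0≤q)

    *-pos : ∀ {p q} → 0ℚ < p → 0ℚ < q → 0ℚ < p * q
    *-pos {p} {q} 0<p 0<q =
      ℚ.positive⁻¹ (p * q) ⦃ ℚ.pos*pos⇒pos p ⦃ ℚ.positive 0<p ⦄ q ⦃ ℚ.positive 0<q ⦄ ⦄

    +-nonNeg : ∀ {p q} → 0ℚ ≤ p → 0ℚ ≤ q → 0ℚ ≤ p + q
    +-nonNeg 0≤p 0≤q = ≤-respˡ (ℚ.+-identityˡ 0ℚ) (ℚ.+-mono-≤ 0≤p 0≤q)

    ≤-+ʳ : ∀ {p q} → 0ℚ ≤ q → p ≤ p + q
    ≤-+ʳ {p} 0≤q = ≤-respˡ (ℚ.+-identityʳ p) (ℚ.+-monoʳ-≤ p 0≤q)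

    0<½ : 0ℚ < ½
    0<½ = ℚ.positive⁻¹ ½

    0<1 : 0ℚ < 1ℚ
    0<1 = ℚ.positive⁻¹ 1ℚ

    half-pos : ∀ {ε} → 0ℚ < ε → 0ℚ < ½ * ε
    half-pos = *-pos 0<½

    half+half : ∀ ε → ½ * ε + ½ * ε ≡ ε
    half+half = solve 1 (λ ε → con ½ :* ε :+ con ½ :* ε := ε) refl

    bisect-initial : ∀ q → q + (1ℚ + q + q * q) ≡ (0ℚ + (1ℚ + q)) * (0ℚ + (1ℚ + q))
    bisect-initial = solve 1 (λ q → q :+ (con 1ℚ :+ q :+ q :* q)
      := (con 0ℚ :+ (con 1ℚ :+ q)) :* (con 0ℚ :+ (con 1ℚ :+ q))) refl

    bisect-initial-width : ∀ q → (1ℚ + q) * (1ℚ + 0ℚ) ≡ 1ℚ + q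
    bisect-initial-width = solve 1 (λ q → (con 1ℚ :+ q) :* (con 1ℚ :+ con 0ℚ) := con 1ℚ :+ q) refl

    bisect-halve : ∀ c w → ½ * w * (1ℚ + (1ℚ + c)) + ½ * (w * c) ≡ w * (1ℚ + c)
    bisect-halve = solve 2 (λ c w → con ½ :* w :* (con 1ℚ :+ (con 1ℚ :+ c)) :+ con ½ :* (w :* c)
      := w :* (con 1ℚ :+ c)) refl

    square-halves : ∀ t h → (t + h) * (t + h) + h * h + (h * (t + h) + h * (t + h))
                          ≡ (t + (h + h)) * (t + (h + h))
    square-halves = solve 2 (λ t h →
      (t :+ h) :* (t :+ h) :+ h :* h :+ (h :* (t :+ h) :+ h :* (t :+ h))
      := (t :+ (h :+ h)) :* (t :+ (h :+ h))) refl

    cancel-outer : ∀ a b → a + (- a + - b) ≡ - b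
    cancel-outer = solve 2 (λ a b → a :+ (:- a :+ :- b) := :- b) refl

    cancel-inner : ∀ a b → b + 1ℚ + (- a + - b) ≡ - a + 1ℚ
    cancel-inner = solve 2 (λ a b → b :+ con 1ℚ :+ (:- a :+ :- b) := :- a :+ con 1ℚ) refl

    +-∸-cancel : ∀ b ε → b + ε + - b ≡ ε
    +-∸-cancel = solve 2 (λ b ε → b :+ ε :+ :- b := ε) refl

    neg-minus : ∀ a b → b + - a ≡ - (a + - b)
    neg-minus = solve 2 (λ a b → b :+ :- a := :- (a :+ :- b)) refl

    +-interchange : ∀ a b ε → a + ½ * ε + (b + ½ * ε) ≡ a + b + ε
    +-interchange = solve 3 (λ a b ε →
      a :+ con ½ :* ε :+ (b :+ con ½ :* ε) := a :+ b :+ ε) refl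

    *-factor : ∀ A B e r → A * (e * r) + e * r * B ≡ e * ((A + B) * r)
    *-factor = solve 4 (λ A B e r → A :* (e :* r) :+ e :* r :* B := e :* ((A :+ B) :* r)) refl

    product-difference : ∀ a a' b b' → a' * b' + (a * (b + - b') + (a + - a') * b') ≡ a * b
    product-difference = solve 4 (λ a a' b b' →
      a' :* b' :+ (a :* (b :+ :- b') :+ (a :+ :- a') :* b') := a :* b) refl

    *-rotate : ∀ x y z → x * y * z ≡ x * (z * y)
    *-rotate = solve 3 (λ x y z → x :* y :* z := x :* (z :* y)) refl

    *-exchange : ∀ x y z → x * (y * z) ≡ y * (x * z)
    *-exchange = solve 3 (λ x y z → x :* (y :* z) := y :* (x :* z)) refl

    reciprocal-expand : ∀ a b a' b' e →
      a' * b' * (a + e * (a * b)) ≡ b' * (a * a') + e * ((a * a') * (b * b'))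
    reciprocal-expand = solve 5 (λ a b a' b' e → a' :* b' :* (a :+ e :* (a :* b))
      := b' :* (a :* a') :+ e :* ((a :* a') :* (b :* b'))) refl

    reciprocal-collapse : ∀ b' e → b' * 1ℚ + e * (1ℚ * 1ℚ) ≡ b' + e
    reciprocal-collapse = solve 2 (λ b' e →
      b' :* con 1ℚ :+ e :* (con 1ℚ :* con 1ℚ) := b' :+ e) refl

    q≤∣q∣ : ∀ q → q ≤ ∣ q ∣
    q≤∣q∣ q with ℚ.≤-total 0ℚ q
    ... | inj₁ 0≤q = ℚ.≤-reflexive (sym (ℚ.0≤p⇒∣p∣≡p 0≤q))
    ... | inj₂ q≤0 = ℚ.≤-trans q≤0 (ℚ.nonNegative⁻¹ ∣ q ∣ ⦃ ℚ.∣-∣-nonNeg q ⦄)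

    0≤∣q∣ : ∀ q → 0ℚ ≤ ∣ q ∣
    0≤∣q∣ q = ℚ.nonNegative⁻¹ ∣ q ∣ ⦃ ℚ.∣-∣-nonNeg q ⦄

    ∣∣-≤ : ∀ {p b} → p ≤ b → ℚ.- p ≤ b → ∣ p ∣ ≤ b
    ∣∣-≤ {p} p≤b -p≤b with ℚ.∣p∣≡p∨∣p∣≡-p p
    ... | inj₁ eq = ≤-respˡ (sym eq) p≤b
    ... | inj₂ eq = ≤-respˡ (sym eq) -p≤b

    reciprocal-inverse : ∀ {q} → 0ℚ < q → q * reciprocal q ≡ 1ℚ
    reciprocal-inverse {q} 0<q with q ℚ.≟ 0ℚ
    ... | yes q≡0 = contradiction (sym q≡0) (ℚ.<⇒≢ 0<q)
    ... | no q≢0  = ℚ.*-inverseʳ q ⦃ ℚ.≢-nonZero q≢0 ⦄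

    reciprocal-pos : ∀ {q} → 0ℚ < q → 0ℚ < reciprocal q
    reciprocal-pos {q} 0<q =
      ℚ.*-cancelˡ-<-nonNeg q ⦃ ℚ.nonNegative (ℚ.<⇒≤ 0<q) ⦄
        (<-resp (sym (ℚ.*-zeroʳ q)) (sym (reciprocal-inverse 0<q)) 0<1)

    square-cancel-≤ : ∀ {p q} → 0ℚ ≤ q → p * p ≤ q * q → p ≤ q
    square-cancel-≤ {p} {q} 0≤q pp≤qq with p ℚ.≤? q
    ... | yes p≤q = p≤q
    ... | no p≰q  = contradiction (ℚ.<-≤-trans qq<pp pp≤qq) (ℚ.<-irrefl refl)
      where
      q<p : q < p
      q<p = ℚ.≰⇒> p≰q
      0<p : 0ℚ < p
      0<p = ℚ.≤-<-trans 0≤q q<p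
      qq<pp : q * q < p * p
      qq<pp = ℚ.≤-<-trans (*-monoˡ 0≤q (ℚ.<⇒≤ q<p))
                          (ℚ.*-monoˡ-<-pos p ⦃ ℚ.positive 0<p ⦄ q<p)

    ι : ℕ → ℚ
    ι zero    = 0ℚ
    ι (suc k) = 1ℚ + ι k

    0≤ι : ∀ k → 0ℚ ≤ ι k
    0≤ι zero    = ℚ.≤-refl
    0≤ι (suc k) = +-nonNeg (ℚ.<⇒≤ 0<1) (0≤ι k)

    0<1+ι : ∀ k → 0ℚ < 1ℚ + ι k
    0<1+ι k = ℚ.<-≤-trans 0<1 (≤-+ʳ (0≤ι k))

    ι-mono : ∀ {m n} → m ℕ.≤ n → ι m ≤ ι n
    ι-mono {n = n} ℕ.z≤n = 0≤ι n
    ι-mono (ℕ.s≤s m≤n) = ℚ.+-monoʳ-≤ 1ℚ (ι-mono m≤n)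

    ι-unnormalised : ∀ k → ℚ.toℚᵘ (ι k) ℚᵘ.≃ ℚᵘ.mkℚᵘ (ℤ.+ k) 0
    ι-unnormalised zero    = ℚᵘ.≃-refl
    ι-unnormalised (suc k) = ℚᵘ.≃-trans (ℚ.toℚᵘ-homo-+ 1ℚ (ι k))
      (ℚᵘ.≃-trans (ℚᵘ.+-congʳ ℚᵘ.1ℚᵘ (ι-unnormalised k))
        (ℚᵘ.*≡* (cong (λ i → (ℤ.1ℤ ℤ.+ i) ℤ.* ℤ.1ℤ) (ℤ.*-identityʳ (ℤ.+ k)))))

    archimedean : ∀ q → ∃[ k ] q ≤ ι k
    archimedean q@(ℚ.mkℚ n d _) = ℤ.∣ n ∣ , ℚ.toℚᵘ-cancel-≤
      (ℚᵘ.≤-respʳ-≃ (ℚᵘ.≃-sym (ι-unnormalised ℤ.∣ n ∣)) (ℚᵘ.*≤* (bound n)))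
      where
      bound : ∀ n → n ℤ.* ℤ.1ℤ ℤ.≤ ℤ.+ ℤ.∣ n ∣ ℤ.* ℤ.+ suc d
      bound (ℤ.+ m) = ℤ.*-monoˡ-≤-nonNeg (ℤ.+ m) (ℤ.+≤+ (ℕ.s≤s ℕ.z≤n))
      bound ℤ.-[1+ m ] = ℤ.-≤+

    bisect-spec : ∀ {q} k → 0ℚ ≤ q → let (s , w) = bisect q k in
      0ℚ ≤ s × 0ℚ ≤ w × s * s ≤ q × q ≤ (s + w) * (s + w)
    bisect-spec {q} zero 0≤q = ℚ.≤-refl , 0≤1+q , 0≤q , q≤[1+q]²
      where
      0≤1+q : 0ℚ ≤ 1ℚ + q
      0≤1+q = +-nonNeg (ℚ.<⇒≤ 0<1) 0≤q
      q≤[1+q]² : q ≤ (0ℚ + (1ℚ + q)) * (0ℚ + (1ℚ + q))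
      q≤[1+q]² = ≤-respʳ
        (bisect-initial q)
        (≤-+ʳ (+-nonNeg 0≤1+q (*-nonNeg 0≤q 0≤q)))
    bisect-spec {q} (suc k) 0≤q with bisect q k | bisect-spec k 0≤q
    ... | s , w | 0≤s , 0≤w , ss≤q , q≤tt with (s + ½ * w) * (s + ½ * w) ℚ.≤? q
    ...   | yes mm≤q = +-nonNeg 0≤s 0≤½w , 0≤½w , mm≤q ,
                       subst (λ t → q ≤ t * t) (sym s+½w+½w≡s+w) q≤tt
      where
      0≤½w : 0ℚ ≤ ½ * w
      0≤½w = *-nonNeg (ℚ.<⇒≤ 0<½) 0≤w
      s+½w+½w≡s+w : s + ½ * w + ½ * w ≡ s + w
      s+½w+½w≡s+w = trans (ℚ.+-assoc s (½ * w) (½ * w)) (cong (s +_) (half+half w))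
    ...   | no  mm≰q = 0≤s , *-nonNeg (ℚ.<⇒≤ 0<½) 0≤w , ss≤q , ℚ.<⇒≤ (ℚ.≰⇒> mm≰q)

    bisect-shrink : ∀ {c w} → 0ℚ ≤ w → 0ℚ ≤ c → ½ * w * (1ℚ + (1ℚ + c)) ≤ w * (1ℚ + c)
    bisect-shrink {c} {w} 0≤w 0≤c = ≤-respʳ (bisect-halve c w)
      (≤-+ʳ (*-nonNeg (ℚ.<⇒≤ 0<½) (*-nonNeg 0≤w 0≤c)))

    bisect-width : ∀ {q} k → 0ℚ ≤ q → proj₂ (bisect q k) * (1ℚ + ι k) ≤ 1ℚ + q
    bisect-width {q} zero 0≤q = ℚ.≤-reflexive
      (bisect-initial-width q)
    bisect-width {q} (suc k) 0≤q with bisect q k | bisect-spec k 0≤q | bisect-width k 0≤q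
    ... | s , w | _ , 0≤w , _ | ih with (s + ½ * w) * (s + ½ * w) ℚ.≤? q
    ...   | yes _ = ℚ.≤-trans (bisect-shrink 0≤w (0≤ι k)) ih
    ...   | no _ = ℚ.≤-trans (bisect-shrink 0≤w (0≤ι k)) ih

-- Since m and n are interchangeable this is ∣ f m - f n ∣ ≤ ε.
Cauchy : (ℕ → ℚ) → Set
Cauchy f = ∀ ε → 0ℚ ℚ.< ε → ∃[ N ] ∀ m n → N ℕ.≤ m → N ℕ.≤ n → f m ℚ.≤ f n ℚ.+ ε

module Convergence where

  open Rational
  open import Data.Rational using (_+_; _*_; _-_; -_; _≤_; _<_; _⊔_; ∣_∣)

  abstract

    const-cauchy : ∀ q → Cauchy (λ _ → q)
    const-cauchy q ε 0<ε = 0 , λ _ _ _ _ → ≤-+ʳ (ℚ.<⇒≤ 0<ε)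

    +-cauchy : ∀ {f g} → Cauchy f → Cauchy g → Cauchy (λ n → f n + g n)
    +-cauchy {f} {g} F G ε 0<ε with F (½ * ε) (half-pos 0<ε) | G (½ * ε) (half-pos 0<ε)
    ... | M , p | N , q = M ℕ.⊔ N , λ m n M⊔N≤m M⊔N≤n →
      ≤-respʳ (+-interchange (f n) (g n) ε)
        (ℚ.+-mono-≤ (p m n (ℕ.m⊔n≤o⇒m≤o M N M⊔N≤m) (ℕ.m⊔n≤o⇒m≤o M N M⊔N≤n))
                    (q m n (ℕ.m⊔n≤o⇒n≤o M N M⊔N≤m) (ℕ.m⊔n≤o⇒n≤o M N M⊔N≤n)))

    ⊔-cauchy : ∀ {f g} → Cauchy f → Cauchy g → Cauchy (λ n → f n ⊔ g n)
    ⊔-cauchy {f} {g} F G ε 0<ε with F ε 0<ε | G ε 0<ε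
    ... | M , p | N , q = M ℕ.⊔ N , λ m n M⊔N≤m M⊔N≤n → ℚ.⊔-lub
      (ℚ.≤-trans (p m n (ℕ.m⊔n≤o⇒m≤o M N M⊔N≤m) (ℕ.m⊔n≤o⇒m≤o M N M⊔N≤n))
                 (ℚ.+-monoˡ-≤ ε (ℚ.p≤p⊔q (f n) (g n))))
      (ℚ.≤-trans (q m n (ℕ.m⊔n≤o⇒n≤o M N M⊔N≤m) (ℕ.m⊔n≤o⇒n≤o M N M⊔N≤n))
                 (ℚ.+-monoˡ-≤ ε (ℚ.p≤q⊔p (f n) (g n))))

    bounded : ∀ {f} → Cauchy f → ∃[ B ] (0ℚ < B × ∃[ N ] ∀ n → N ℕ.≤ n → ∣ f n ∣ ≤ B)
    bounded {f} F with F 1ℚ 0<1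
    ... | N , p = ∣ f N ∣ + 1ℚ
                , ℚ.<-≤-trans 0<1 (≤-respʳ (ℚ.+-comm 1ℚ ∣ f N ∣) (≤-+ʳ (0≤∣q∣ (f N))))
                , N , λ n N≤n → ∣∣-≤
      (ℚ.≤-trans (p n N N≤n ℕ.≤-refl) (ℚ.+-monoˡ-≤ 1ℚ (q≤∣q∣ (f N))))
      (ℚ.≤-trans (swap (f N) (f n) (p N n ℕ.≤-refl N≤n))
                 (ℚ.+-monoˡ-≤ 1ℚ (≤-respʳ (ℚ.∣-p∣≡∣p∣ (f N)) (q≤∣q∣ (- f N)))))
      where
      swap : ∀ a b → a ≤ b + 1ℚ → - b ≤ - a + 1ℚ
      swap a b a≤b+1 = ≤-resp
        (cancel-outer a b)
        (cancel-inner a b)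
        (ℚ.+-monoˡ-≤ (- a + - b) a≤b+1)

    ∣-∣-≤ : ∀ {a b ε} → a ≤ b + ε → b ≤ a + ε → ∣ a - b ∣ ≤ ε
    ∣-∣-≤ {a} {b} {ε} a≤b+ε b≤a+ε = ∣∣-≤
      (≤-respʳ (+-∸-cancel b ε)
        (ℚ.+-monoˡ-≤ (- b) a≤b+ε))
      (≤-resp (neg-minus a b)
                  (+-∸-cancel a ε)
        (ℚ.+-monoˡ-≤ (- a) b≤a+ε))

    *-cauchy : ∀ {f g} → Cauchy f → Cauchy g → Cauchy (λ n → f n * g n)
    *-cauchy {f} {g} F G ε 0<ε with bounded F | bounded G
    ... | A , 0<A , M , ∣f∣≤A | B , 0<B , N , ∣g∣≤B
      with F (ε * reciprocal (A + B)) (δ-pos 0<A 0<B) | G (ε * reciprocal (A + B)) (δ-pos 0<A 0<B)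
      where
      δ-pos : ∀ {A B} → 0ℚ < A → 0ℚ < B → 0ℚ < ε * reciprocal (A + B)
      δ-pos 0<A 0<B = *-pos 0<ε (reciprocal-pos (ℚ.+-mono-< 0<A 0<B))
    ... | P , p | Q , q = (M ℕ.⊔ N) ℕ.⊔ (P ℕ.⊔ Q) , λ m n K≤m K≤n →
      let MN≤m = ℕ.m⊔n≤o⇒m≤o (M ℕ.⊔ N) (P ℕ.⊔ Q) K≤m
          PQ≤m = ℕ.m⊔n≤o⇒n≤o (M ℕ.⊔ N) (P ℕ.⊔ Q) K≤m
          MN≤n = ℕ.m⊔n≤o⇒m≤o (M ℕ.⊔ N) (P ℕ.⊔ Q) K≤n
          PQ≤n = ℕ.m⊔n≤o⇒n≤o (M ℕ.⊔ N) (P ℕ.⊔ Q) K≤n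
          P≤m = ℕ.m⊔n≤o⇒m≤o P Q PQ≤m
          P≤n = ℕ.m⊔n≤o⇒m≤o P Q PQ≤n
          Q≤m = ℕ.m⊔n≤o⇒n≤o P Q PQ≤m
          Q≤n = ℕ.m⊔n≤o⇒n≤o P Q PQ≤n
      in close (f m) (f n) (g m) (g n)
           (∣f∣≤A m (ℕ.m⊔n≤o⇒m≤o M N MN≤m)) (∣g∣≤B n (ℕ.m⊔n≤o⇒n≤o M N MN≤n))
           (∣-∣-≤ (p m n P≤m P≤n) (p n m P≤n P≤m)) (∣-∣-≤ (q m n Q≤m Q≤n) (q n m Q≤n Q≤m))
      where
      δ : ℚ
      δ = ε * reciprocal (A + B)
      0<A+B : 0ℚ < A + B
      0<A+B = ℚ.+-mono-< 0<A 0<B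
      0≤δ : 0ℚ ≤ δ
      0≤δ = ℚ.<⇒≤ (*-pos 0<ε (reciprocal-pos 0<A+B))
      Aδ+δB≡ε : A * δ + δ * B ≡ ε
      Aδ+δB≡ε = trans
        (*-factor A B ε (reciprocal (A + B)))
        (trans (cong (ε *_) (reciprocal-inverse 0<A+B)) (ℚ.*-identityʳ ε))
      product : ∀ {a b C D} → ∣ a ∣ ≤ C → ∣ b ∣ ≤ D → 0ℚ ≤ D → a * b ≤ C * D
      product {a} {b} ∣a∣≤C ∣b∣≤D 0≤D = ℚ.≤-trans (q≤∣q∣ (a * b))
        (≤-respˡ (sym (ℚ.∣p*q∣≡∣p∣*∣q∣ a b)) (*-mono (0≤∣q∣ a) 0≤D ∣a∣≤C ∣b∣≤D))
      close : ∀ a a' b b' → ∣ a ∣ ≤ A → ∣ b' ∣ ≤ B → ∣ a - a' ∣ ≤ δ → ∣ b - b' ∣ ≤ δ →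
              a * b ≤ a' * b' + ε
      close a a' b b' ∣a∣≤A ∣b'∣≤B ∣a-a'∣≤δ ∣b-b'∣≤δ = ≤-resp
        (product-difference a a' b b')
        (cong (λ e → a' * b' + e) Aδ+δB≡ε)
        (ℚ.+-monoʳ-≤ (a' * b')
          (ℚ.+-mono-≤ (product ∣a∣≤A ∣b-b'∣≤δ 0≤δ) (product ∣a-a'∣≤δ ∣b'∣≤B (ℚ.<⇒≤ 0<B))))

    -- The hypothesis on f says that its limit is positive.
    reciprocal-cauchy : ∀ {f} → Cauchy f →
      ∃[ ε ] (0ℚ < ε × ∃[ N ] ∀ n → N ℕ.≤ n → 0ℚ + ε ≤ f n) →
      Cauchy (λ n → reciprocal (f n))
    reciprocal-cauchy {f} F (δ , 0<δ , N , δ≤f) ε 0<ε with F (ε * (δ * δ)) (*-pos 0<ε (*-pos 0<δ 0<δ))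
    ... | M , p = M ℕ.⊔ N , λ m n K≤m K≤n →
      close (f m) (f n) (δ≤f' m (ℕ.m⊔n≤o⇒n≤o M N K≤m)) (δ≤f' n (ℕ.m⊔n≤o⇒n≤o M N K≤n))
        (p n m (ℕ.m⊔n≤o⇒m≤o M N K≤n) (ℕ.m⊔n≤o⇒m≤o M N K≤m))
      where
      δ≤f' : ∀ n → N ℕ.≤ n → δ ≤ f n
      δ≤f' n N≤n = ≤-respˡ (ℚ.+-identityˡ δ) (δ≤f n N≤n)
      close : ∀ a b → δ ≤ a → δ ≤ b → b ≤ a + ε * (δ * δ) → reciprocal a ≤ reciprocal b + ε
      close a b δ≤a δ≤b b≤a+εδδ = ≤-resp left right
        (*-monoˡ (*-nonNeg (ℚ.<⇒≤ (reciprocal-pos 0<a)) (ℚ.<⇒≤ (reciprocal-pos 0<b)))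
          (ℚ.≤-trans b≤a+εδδ (ℚ.+-monoʳ-≤ a (*-monoˡ (ℚ.<⇒≤ 0<ε)
            (*-mono (ℚ.<⇒≤ 0<δ) (ℚ.<⇒≤ 0<b) δ≤a δ≤b)))))
        where
        0<a : 0ℚ < a
        0<a = ℚ.<-≤-trans 0<δ δ≤a
        0<b : 0ℚ < b
        0<b = ℚ.<-≤-trans 0<δ δ≤b
        a⁻¹ b⁻¹ : ℚ
        a⁻¹ = reciprocal a
        b⁻¹ = reciprocal b
        left : a⁻¹ * b⁻¹ * b ≡ a⁻¹
        left = trans (*-rotate a⁻¹ b⁻¹ b)
                     (trans (cong (a⁻¹ *_) (reciprocal-inverse 0<b)) (ℚ.*-identityʳ a⁻¹))
        right : a⁻¹ * b⁻¹ * (a + ε * (a * b)) ≡ b⁻¹ + ε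
        right = trans
          (reciprocal-expand a b a⁻¹ b⁻¹ ε)
          (trans (cong (λ u → b⁻¹ * u + ε * (u * (b * b⁻¹))) (reciprocal-inverse 0<a))
          (trans (cong (λ u → b⁻¹ * 1ℚ + ε * (1ℚ * u)) (reciprocal-inverse 0<b)) (reciprocal-collapse b⁻¹ ε)))

    sqrt-cauchy : ∀ {f} → Cauchy f → (∀ n → 0ℚ ≤ f n) → Cauchy (λ n → proj₁ (bisect (f n) n))
    sqrt-cauchy {f} F 0≤f ε 0<ε with bounded F | F (½ * ε * (½ * ε)) (*-pos (half-pos 0<ε) (half-pos 0<ε))
    ... | B , 0<B , N , ∣f∣≤B | M , p with archimedean ((1ℚ + B) * reciprocal (½ * ε))
    ...   | K , 1+B≤Kh = K ℕ.⊔ (M ℕ.⊔ N) , λ m n ≤m ≤n →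
      let MN≤m = ℕ.m⊔n≤o⇒n≤o K (M ℕ.⊔ N) ≤m
          MN≤n = ℕ.m⊔n≤o⇒n≤o K (M ℕ.⊔ N) ≤n
      in close m n (ℕ.m⊔n≤o⇒m≤o K (M ℕ.⊔ N) ≤n) (ℕ.m⊔n≤o⇒n≤o M N MN≤n)
           (p m n (ℕ.m⊔n≤o⇒m≤o M N MN≤m) (ℕ.m⊔n≤o⇒m≤o M N MN≤n))
      where
      h : ℚ
      h = ½ * ε
      0<h : 0ℚ < h
      0<h = half-pos 0<ε
      0≤h : 0ℚ ≤ h
      0≤h = ℚ.<⇒≤ 0<h
      1+B≤h[1+ι] : ∀ n → K ℕ.≤ n → 1ℚ + B ≤ h * (1ℚ + ι n)
      1+B≤h[1+ι] n K≤n = ≤-respˡ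
        (trans (*-exchange h (1ℚ + B) (reciprocal h))
          (trans (cong ((1ℚ + B) *_) (reciprocal-inverse 0<h)) (ℚ.*-identityʳ (1ℚ + B))))
        (*-monoˡ 0≤h (ℚ.≤-trans 1+B≤Kh (ℚ.≤-trans (ι-mono K≤n)
          (≤-respʳ (ℚ.+-comm (ι n) 1ℚ) (≤-+ʳ (ℚ.<⇒≤ 0<1))))))
      width≤h : ∀ n → K ℕ.≤ n → N ℕ.≤ n → proj₂ (bisect (f n) n) ≤ h
      width≤h n K≤n N≤n = ℚ.*-cancelʳ-≤-pos (1ℚ + ι n) ⦃ ℚ.positive (0<1+ι n) ⦄
        (ℚ.≤-trans (bisect-width n (0≤f n))
          (ℚ.≤-trans (ℚ.+-monoʳ-≤ 1ℚ (ℚ.≤-trans (q≤∣q∣ (f n)) (∣f∣≤B n N≤n))) (1+B≤h[1+ι] n K≤n)))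
      close : ∀ m n → K ℕ.≤ n → N ℕ.≤ n → f m ≤ f n + h * h →
              proj₁ (bisect (f m) m) ≤ proj₁ (bisect (f n) n) + ε
      close m n K≤n N≤n fm≤fn+hh
        with bisect (f m) m | bisect-spec m (0≤f m)
           | bisect (f n) n | bisect-spec n (0≤f n) | width≤h n K≤n N≤n
      ... | s , _ | _ , _ , ss≤fm , _ | t , w | 0≤t , 0≤w , _ , fn≤[t+w]² | w≤h =
        square-cancel-≤ (+-nonNeg 0≤t (ℚ.<⇒≤ 0<ε))
          (ℚ.≤-trans ss≤fm (ℚ.≤-trans fm≤fn+hh (ℚ.≤-trans
            (ℚ.+-monoˡ-≤ (h * h) (ℚ.≤-trans fn≤[t+w]²
              (*-mono (+-nonNeg 0≤t 0≤w) (+-nonNeg 0≤t 0≤h) (ℚ.+-monoʳ-≤ t w≤h) (ℚ.+-monoʳ-≤ t w≤h))))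
            (≤-respʳ
              (trans (square-halves t h) (cong (λ e → (t + e) * (t + e)) (half+half ε)))
              (≤-+ʳ (+-nonNeg 0≤h[t+h] 0≤h[t+h]))))))
        where
        0≤h[t+h] : 0ℚ ≤ h * (t + h)
        0≤h[t+h] = *-nonNeg 0≤h (+-nonNeg 0≤t 0≤h)

open Rational using (reciprocal; bisect)
open Convergence

record ℝ : Set where
  constructor mkℝ
  field
    seq    : ℕ → ℚ
    cauchy : Cauchy seq

open ℝ public

infix 4 _≤_ _<_

_≤_ : ℝ → ℝ → Set
x ≤ y = ∀ ε → 0ℚ ℚ.< ε → ∃[ N ] ∀ n → N ℕ.≤ n → seq x n ℚ.≤ seq y n ℚ.+ ε

_<_ : ℝ → ℝ → Set
x < y = ∃[ ε ] (0ℚ ℚ.< ε × ∃[ N ] ∀ n → N ℕ.≤ n → seq x n ℚ.+ ε ℚ.≤ seq y n)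

infixl 7 _*_
infixl 6 _+_
infixl 5 _⊔_

fromℚ : ℚ → ℝ
fromℚ q = mkℝ (λ _ → q) (const-cauchy q)

0ℝ 1ℝ : ℝ
0ℝ = fromℚ 0ℚ
1ℝ = fromℚ 1ℚ

_+_ : ℝ → ℝ → ℝ
x + y = mkℝ (λ n → seq x n ℚ.+ seq y n) (+-cauchy (cauchy x) (cauchy y))

_*_ : ℝ → ℝ → ℝ
x * y = mkℝ (λ n → seq x n ℚ.* seq y n) (*-cauchy (cauchy x) (cauchy y))

_⊔_ : ℝ → ℝ → ℝ
x ⊔ y = mkℝ (λ n → seq x n ℚ.⊔ seq y n) (⊔-cauchy (cauchy x) (cauchy y))

inverse : (x : ℝ) → 0ℝ < x → ℝ
inverse x 0<x = mkℝ (λ n → reciprocal (seq x n)) (reciprocal-cauchy (cauchy x) 0<x)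

-- √ x is the square root of max(x, 0); its n-th term is a lower approximation of the
-- square root of the n-th term of x, found by n bisection steps.
√_ : ℝ → ℝ
√ x = mkℝ (λ n → proj₁ (bisect (seq x n ℚ.⊔ 0ℚ) n))
          (sqrt-cauchy (cauchy (x ⊔ 0ℝ)) (λ n → ℚ.p≤q⊔p (seq x n) 0ℚ))

abstract

  1≤⇒0< : ∀ x → 1ℝ ≤ x → 0ℝ < x
  1≤⇒0< x 1≤x with 1≤x ½ Rational.0<½
  ... | N , p = ½ , Rational.0<½ , N , λ n N≤n →
    ℚ.≤-trans (ℚ.+-monoˡ-≤ (ℚ.- ½) (p n N≤n))
      (ℚ.≤-reflexive (solve 1 (λ q → q :+ con ½ :+ con (ℚ.- ½) := q) refl (seq x n)))

  *-pos : ∀ x y → 0ℝ < x → 0ℝ < y → 0ℝ < x * y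
  *-pos x y (δ , 0<δ , M , δ≤x) (ε , 0<ε , N , ε≤y) =
    δ ℚ.* ε , Rational.*-pos 0<δ 0<ε , M ℕ.⊔ N , λ n K≤n →
      subst (ℚ._≤ seq x n ℚ.* seq y n) (sym (ℚ.+-identityˡ (δ ℚ.* ε)))
        (product (subst (ℚ._≤ seq x n) (ℚ.+-identityˡ δ) (δ≤x n (ℕ.m⊔n≤o⇒m≤o M N K≤n)))
                 (subst (ℚ._≤ seq y n) (ℚ.+-identityˡ ε) (ε≤y n (ℕ.m⊔n≤o⇒n≤o M N K≤n))))
    where
    product : ∀ {a b} → δ ℚ.≤ a → ε ℚ.≤ b → δ ℚ.* ε ℚ.≤ a ℚ.* b
    product δ≤a ε≤b = Rational.*-mono (ℚ.<⇒≤ 0<δ) (ℚ.≤-trans (ℚ.<⇒≤ 0<ε) ε≤b) δ≤a ε≤b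

record Instance : Set where
  field
    n   : ℕ
    t   : Fin n → ℝ
    u   : Fin n → ℝ
    p   : Fin n → ℝ
    0≤t : ∀ j → 0ℝ ≤ t j
    0≤u : ∀ j → 0ℝ ≤ u j
    0≤p : ∀ j → 0ℝ ≤ p j
    p≤u : ∀ j → p j ≤ u j

data Kind : Set where
  testing execution execution-untested : Kind

data Action (n : ℕ) : Set where
  task : Fin n → Kind → Action n
  idle : (d : ℝ) → 0ℝ ≤ d → Action n

-- The actions of the machine in temporal order, from time 0 on.
Schedule : ℕ → Set
Schedule n = List (Action n)

tasksOf : ∀ {n} → Fin n → Schedule n → List Kind
tasksOf j []               = []
tasksOf j (idle _ _ ∷ S)   = tasksOf j S
tasksOf j (task i k ∷ S) with i ≟ j
... | yes _ = k ∷ tasksOf j S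
... | no  _ = tasksOf j S

Feasible : ∀ {n} → Schedule n → Set
Feasible S = ∀ j → (tasksOf j S ≡ execution-untested ∷ [])
                 ⊎ (tasksOf j S ≡ testing ∷ execution ∷ [])

module _ (I : Instance) where

  open Instance I

  duration : Action n → ℝ
  duration (task j testing)            = t j
  duration (task j execution)          = p j
  duration (task j execution-untested) = u j
  duration (idle d _)                  = d

  -- The sum of the completion times of the jobs when S is started at the given time.
  costFrom : ℝ → Schedule n → ℝ
  costFrom now []                                  = 0ℝ
  costFrom now (a@(task _ testing) ∷ S)            = costFrom (now + duration a) S
  costFrom now (a@(task _ execution) ∷ S)          = (now + duration a) + costFrom (now + duration a) S
  costFrom now (a@(task _ execution-untested) ∷ S) = (now + duration a) + costFrom (now + duration a) S
  costFrom now (a@(idle _ _) ∷ S)                  = costFrom (now + duration a) S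

  cost : Schedule n → ℝ
  cost = costFrom 0ℝ

-- An algorithm is given by the schedules it may output on an instance; there can be
-- several, because ties may be broken arbitrarily.
Algorithm : Set₁
Algorithm = (I : Instance) → Schedule (Instance.n I) → Set

-- OPT is the minimum of cost I O over the feasible schedules O.  For c ≥ 0, being at most
-- c times this minimum is being at most c * cost I O for all feasible O; this avoids
-- selecting an optimal O, for which the order on ℝ would have to be decidable.
CompetitiveRatioAtMost : Algorithm → ℝ → Set
CompetitiveRatioAtMost A c =
  ∀ I S → A I S → ∀ O → Feasible O → cost I S ≤ c * cost I O

module _ (I : Instance) where

  open Instance I

  Queue : Set
  Queue = List ((Fin n × Kind) × ℝ)

  data Initial (α β : ℝ) (j : Fin n) : (Fin n × Kind) × ℝ → Set where
    test    : α * t j ≤ u j → Initial α β j ((j , testing) , β * t j)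
    no-test : ¬ (α * t j ≤ u j) → Initial α β j ((j , execution-untested) , u j)

  followUp : Fin n × Kind → Queue
  followUp (j , testing)            = ((j , execution) , t j + p j) ∷ []
  followUp (j , execution)          = []
  followUp (j , execution-untested) = []

  data Run : Queue → Schedule n → Set where
    done : Run [] []
    step : ∀ {Q j k w R S} → Q ↭ ((j , k) , w) ∷ R → All (λ e → w ≤ proj₂ e) R →
           Run (followUp (j , k) ++ R) S → Run Q (task j k ∷ S)

PCP : ℝ → ℝ → Algorithm
PCP α β I S =
  ∃[ Q ] (Pointwise (Initial I α β) (allFin (Instance.n I)) Q × Run I Q S)

2ℝ 5ℝ ½ℝ : ℝ
2ℝ = fromℚ (ℤ.+ 2 ℚ./ 1)
5ℝ = fromℚ (ℤ.+ 5 ℚ./ 1)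
½ℝ = fromℚ ½

φ : ℝ
φ = (1ℝ + √ 5ℝ) * ½ℝ

β* : ℝ
β* = (φ + √ (5ℝ * φ + 1ℝ)) * ½ℝ

ratio : (α β : ℝ) → 1ℝ ≤ α → 1ℝ ≤ β → ℝ
ratio α β 1≤α 1≤β =
  α * (1ℝ + 1/β) ⊔ (1ℝ + 1/α + 1/β + 1/αβ) ⊔ β ⊔ 2ℝ ⊔ (1ℝ + 2ℝ * 1/α)
  where
  0<α = 1≤⇒0< α 1≤α
  0<β = 1≤⇒0< β 1≤β
  1/α = inverse α 0<α
  1/β = inverse β 0<β
  1/αβ = inverse (α * β) (*-pos α β 0<α 0<β)

{-# OPTIONS --safe #-}

-- The cost of a schedule is the sum over all ordered pairs (i, j) of jobs of the work done on i
-- until j is completed, plus the delay caused by idling, so it suffices to compare schedules on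
-- each pair.  If a schedule spends q i in total on each job i, it delays a pair i, j by at least
-- q i or q j, according to which job finishes first.  PCP delays the pair by at most β (q i) and
-- at most β (q j).  Indeed, writing A i for the time PCP spends on i, A i ≤ α (q i) always holds
-- (for α = φ also 1 + 1/α is α), and if i is tested then also t i ≤ q i and t i + A i ≤ β (q i).
-- If the job that finishes first, say j, has no task of i run before its completion, PCP delays
-- the pair by A j, and the weights give A j ≤ A i or A j ≤ β (t i).  Otherwise i is tested before
-- j is completed and the delay is t i + A j with A j ≤ A i.  Then either β (t i) ≤ A j, and
-- t i + A j ≤ (1 + 1/β) A j is bounded through α (1 + 1/β) = β, or i is tested before j, hence
-- t i ≤ t j, and both t i + A i and t j + A j are bounds.

module Submission where

open import Defs
open import Algebra.Bundles using (CommutativeSemiring)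
open import Data.Bool using (if_then_else_)
open import Data.Fin using (Fin; zero; suc; _≟_)
open import Data.Integer using (+_)
open import Data.List using (List; []; _∷_; _++_; filter)
open import Data.List.Membership.Propositional using (_∈_)
open import Data.List.Membership.Propositional.Properties using (∈-allFin)
open import Data.List.Properties using (∷-injective; filter-accept; filter-reject)
open import Data.List.Relation.Binary.Permutation.Propositional using (_↭_; ↭-sym)
open import Data.List.Relation.Binary.Permutation.Propositional.Properties
  using (filter-↭; ↭-singleton-inv; ↭-empty-inv)
open import Data.List.Relation.Binary.Pointwise using (Pointwise; []; _∷_)
open import Data.List.Relation.Unary.All as All using (All; []; _∷_)
import Data.List.Relation.Unary.All.Properties as All
open import Data.List.Relation.Unary.Any using (here; there)
open import Data.List.Relation.Unary.Unique.Propositional using (Unique; []; _∷_)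
open import Data.List.Relation.Unary.Unique.Propositional.Properties using (allFin⁺)
open import Data.Nat as ℕ using (ℕ; zero; suc)
import Data.Nat.Properties as ℕ
open import Data.Product as Product using (_×_; _,_; proj₁; proj₂; Σ-syntax; ∃-syntax)
open import Data.Rational as ℚ using (ℚ; 0ℚ; 1ℚ; ½; _/_)
import Data.Rational.Properties as ℚ
open import Data.Rational.Solver using (module +-*-Solver)
open import Data.Sum as Sum using (_⊎_; inj₁; inj₂)
open import Relation.Binary.Bundles using (Preorder)
open import Relation.Binary.PropositionalEquality
  using (_≡_; _≢_; refl; sym; trans; cong; cong₂; subst)
import Relation.Binary.Reasoning.Preorder
import Relation.Binary.Reasoning.Setoid
open import Relation.Nullary using (¬_; Dec; yes; no; contradiction)
open import Relation.Nullary.Decidable using (True; toWitness; does)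

open Rational hiding (*-pos)
open +-*-Solver using (solve; _:=_; _:+_; _:*_; :-_; con)

-- Ordered arithmetic of the reals

infix 4 _≈_ _≲_

-- Termwise equality, finer than equality of limits. Ring identities between reals then follow index
-- by index from identities in ℚ, where the solver applies.
record _≈_ (x y : ℝ) : Set where
  constructor pointwise
  field at : ∀ n → seq x n ≡ seq y n

-- A record, unlike _≤_, lets Agda infer the reals x and y from the inequality.
record _≲_ (x y : ℝ) : Set where
  constructor wrap
  field unwrap : x ≤ y

open _≈_
open _≲_

Eventually : (ℕ → Set) → Set
Eventually P = ∃[ N ] ∀ n → N ℕ.≤ n → P n

private variable
  x y z w : ℝ

both : ∀ {P Q} → Eventually P → Eventually Q → Eventually (λ n → P n × Q n)
both (M , p) (N , q) = M ℕ.⊔ N , λ n K≤n →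
  p n (ℕ.m⊔n≤o⇒m≤o M N K≤n) , q n (ℕ.m⊔n≤o⇒n≤o M N K≤n)

eventually-map : ∀ {P Q : ℕ → Set} → (∀ n → P n → Q n) → Eventually P → Eventually Q
eventually-map f (N , p) = N , λ n N≤n → f n (p n N≤n)

-- The pointwise form of monotonicity of multiplication: r, x, y are approximations, and
-- the hypotheses 0 ≤ r and x ≤ y hold up to δ and η.
approx-* : ∀ {r x y B C δ η} → 0ℚ ℚ.≤ r ℚ.+ δ → x ℚ.≤ y ℚ.+ η → r ℚ.≤ B → y ℚ.- x ℚ.≤ C →
           0ℚ ℚ.≤ δ → 0ℚ ℚ.≤ η → r ℚ.* x ℚ.≤ r ℚ.* y ℚ.+ (δ ℚ.* C ℚ.+ (B ℚ.+ δ) ℚ.* η)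
approx-* {r} {x} {y} {B} {C} {δ} {η} 0≤r+δ x≤y+η r≤B y-x≤C 0≤δ 0≤η =
  -- Since `r` itself may be negative, the inequality of `x` and `y + η` is multiplied by `r + δ`,
  -- and `δ * x` is subtracted afterwards.
  ℚ.≤-trans
    (≤-resp
      (solve 3 (λ r x δ → (r :+ δ) :* x :+ :- (δ :* x) := r :* x) refl r x δ)
      (solve 5 (λ r x y δ η → (r :+ δ) :* (y :+ η) :+ :- (δ :* x)
         := r :* y :+ (δ :* (y :+ :- x) :+ (r :+ δ) :* η)) refl r x y δ η)
      (ℚ.+-monoˡ-≤ (ℚ.- (δ ℚ.* x)) (*-monoˡ 0≤r+δ x≤y+η)))
    (ℚ.+-monoʳ-≤ (r ℚ.* y)
      (ℚ.+-mono-≤ (*-monoˡ 0≤δ y-x≤C) (*-monoʳ 0≤η (ℚ.+-monoˡ-≤ δ r≤B))))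


cancel-scaled : ∀ {b} ε → 0ℚ ℚ.< b → b ℚ.* (ε ℚ.* reciprocal b) ≡ ε
cancel-scaled {b} ε 0<b =
  trans (*-exchange b ε (reciprocal b))
        (trans (cong (ε ℚ.*_) (reciprocal-inverse 0<b)) (ℚ.*-identityʳ ε))


≈⇒≲ : x ≈ y → x ≲ y
≈⇒≲ x≈y = wrap λ ε 0<ε → 0 , λ n _ →
  ≤-respˡ (sym (at x≈y n)) (≤-+ʳ (ℚ.<⇒≤ 0<ε))

≲-refl : x ≲ x
≲-refl = ≈⇒≲ (pointwise λ _ → refl)

≲-trans : x ≲ y → y ≲ z → x ≲ z
≲-trans {x} {y} {z} (wrap x≤y) (wrap y≤z) = wrap λ ε 0<ε →
  eventually-map
    (λ n (p , q) → ℚ.≤-trans p (≤-respʳ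
      (trans (ℚ.+-assoc (seq z n) (½ ℚ.* ε) (½ ℚ.* ε))
             (cong (seq z n ℚ.+_) (half+half ε)))
      (ℚ.+-monoˡ-≤ (½ ℚ.* ε) q)))
    (both (x≤y _ (half-pos 0<ε)) (y≤z _ (half-pos 0<ε)))

+-mono-≲ : x ≲ y → z ≲ w → x + z ≲ y + w
+-mono-≲ {x} {y} {z} {w} (wrap x≤y) (wrap z≤w) = wrap λ ε 0<ε →
  eventually-map
    (λ n (p , q) → ≤-respʳ (+-interchange (seq y n) (seq w n) ε)
      (ℚ.+-mono-≤ p q))
    (both (x≤y _ (half-pos 0<ε)) (z≤w _ (half-pos 0<ε)))

*-monoˡ-≲ : ∀ {r x y} → 0ℝ ≲ r → x ≲ y → r * x ≲ r * y
*-monoˡ-≲ {r} {x} {y} (wrap 0≤r) (wrap x≤y) = wrap mono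
  where
  mono : r * x ≤ r * y
  mono ε 0<ε with Convergence.bounded (cauchy r)
                | Convergence.bounded (cauchy x) | Convergence.bounded (cauchy y)
  ... | B , 0<B , ∣r∣≤B | X , 0<X , ∣x∣≤X | Y , 0<Y , ∣y∣≤Y =
    eventually-map
      (λ n ((∣r∣≤B , ∣x∣≤X , ∣y∣≤Y) , 0≤r+δ , x≤y+η) →
        subst (λ e → seq r n ℚ.* seq x n ℚ.≤ seq r n ℚ.* seq y n ℚ.+ e) total
          (approx-* 0≤r+δ x≤y+η (ℚ.≤-trans (q≤∣q∣ _) ∣r∣≤B)
            (ℚ.+-mono-≤ (ℚ.≤-trans (q≤∣q∣ _) ∣y∣≤Y)
              (ℚ.≤-trans (≤-respʳ (ℚ.∣-p∣≡∣p∣ (seq x n)) (q≤∣q∣ (ℚ.- seq x n))) ∣x∣≤X))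
            (ℚ.<⇒≤ 0<δ) (ℚ.<⇒≤ 0<η)))
      (both (both ∣r∣≤B (both ∣x∣≤X ∣y∣≤Y)) (both (0≤r δ 0<δ) (x≤y η 0<η)))
    where
    -- `C` bounds `y - x`, and the tolerances make `δ * C` and `(B + δ) * η` equal to half of `ε`
    -- each.
    C δ η : ℚ
    0<C : 0ℚ ℚ.< Y ℚ.+ X
    0<C = ℚ.+-mono-< 0<Y 0<X
    C = Y ℚ.+ X
    δ = ½ ℚ.* ε ℚ.* reciprocal C
    0<δ : 0ℚ ℚ.< δ
    0<δ = Rational.*-pos (half-pos 0<ε) (reciprocal-pos 0<C)
    η = ½ ℚ.* ε ℚ.* reciprocal (B ℚ.+ δ)
    0<B+δ : 0ℚ ℚ.< B ℚ.+ δ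
    0<B+δ = ℚ.+-mono-< 0<B 0<δ
    0<η : 0ℚ ℚ.< η
    0<η = Rational.*-pos (half-pos 0<ε) (reciprocal-pos 0<B+δ)
    total : δ ℚ.* C ℚ.+ (B ℚ.+ δ) ℚ.* η ≡ ε
    total = trans
      (cong₂ ℚ._+_
        (trans (ℚ.*-comm δ C) (cancel-scaled (½ ℚ.* ε) 0<C))
        (cancel-scaled (½ ℚ.* ε) 0<B+δ))
      (half+half ε)

-- The terms of `s` are eventually at least ½, so an error of `½ * ε` in the products is at most
-- `s * ε` and becomes at most `ε` after division.
*-cancelʳ-≲ : ∀ s → 1ℝ ≲ s → x * s ≲ y * s → x ≲ y
*-cancelʳ-≲ {x} {y} s (wrap 1≤s) (wrap xs≤ys) = wrap λ ε 0<ε →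
  eventually-map
    (λ n (1≤s+½ , xs≤ys+½ε) → cancel (seq x n) (seq y n) (seq s n) ε 0<ε 1≤s+½ xs≤ys+½ε)
    (both (1≤s ½ 0<½) (xs≤ys _ (half-pos 0<ε)))
  where
  cancel : ∀ x y s ε → 0ℚ ℚ.< ε → 1ℚ ℚ.≤ s ℚ.+ ½ → x ℚ.* s ℚ.≤ y ℚ.* s ℚ.+ ½ ℚ.* ε →
           x ℚ.≤ y ℚ.+ ε
  cancel x y s ε 0<ε 1≤s+½ xs≤ys+½ε =
    ℚ.*-cancelʳ-≤-pos s ⦃ ℚ.positive (ℚ.<-≤-trans 0<½ ½≤s) ⦄
      (ℚ.≤-trans xs≤ys+½ε (≤-respʳ
        (solve 3 (λ y s ε → y :* s :+ s :* ε := (y :+ ε) :* s) refl y s ε)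
        (ℚ.+-monoʳ-≤ (y ℚ.* s) (*-monoʳ (ℚ.<⇒≤ 0<ε) ½≤s))))
    where
    ½≤s : ½ ℚ.≤ s
    ½≤s = ≤-resp refl (solve 1 (λ s → s :+ con ½ :+ con (ℚ.- ½) := s) refl s)
            (ℚ.+-monoˡ-≤ (ℚ.- ½) 1≤s+½)

-- Constructive because each `ε` is treated separately: at one index beyond both Cauchy moduli for
-- `ε / 4`, it is decidable whether `y` exceeds `x` by more than `ε / 2`. If not, `y` stays below
-- `x + ε` from there on; if so, `x` stays below `y`, contrary to the hypothesis.
≰⇒≳ : ¬ (x ≲ y) → y ≲ x
≰⇒≳ {x} {y} x≰y = wrap λ ε 0<ε → decide ε (half-pos (half-pos 0<ε))
  where
  lower : ∀ a b c d h → a ℚ.≤ b ℚ.+ h → ¬ (c ℚ.≤ b ℚ.+ (h ℚ.+ h)) → c ℚ.≤ d ℚ.+ h → a ℚ.≤ d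
  lower a b c d h a≤b+h c≰b+2h c≤d+h =
    ≤-resp
      (solve 3 (λ a b h → a :+ (b :+ (h :+ h)) :+ :- (b :+ (h :+ h)) := a) refl a b h)
      (solve 3 (λ b d h → b :+ h :+ (d :+ h) :+ :- (b :+ (h :+ h)) := d) refl b d h)
      (ℚ.+-monoˡ-≤ (ℚ.- (b ℚ.+ (h ℚ.+ h)))
        (ℚ.+-mono-≤ a≤b+h (ℚ.≤-trans (ℚ.<⇒≤ (ℚ.≰⇒> c≰b+2h)) c≤d+h)))
  upper : ∀ a b c d h → c ℚ.≤ b ℚ.+ h → b ℚ.≤ a ℚ.+ (h ℚ.+ h) → a ℚ.≤ d ℚ.+ h →
          c ℚ.≤ d ℚ.+ ((h ℚ.+ h) ℚ.+ (h ℚ.+ h))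
  upper a b c d h c≤b+h b≤a+2h a≤d+h =
    ≤-respʳ (solve 2 (λ d h → d :+ h :+ (h :+ h) :+ h := d :+ ((h :+ h) :+ (h :+ h))) refl d h)
      (ℚ.≤-trans c≤b+h (ℚ.+-monoˡ-≤ h (ℚ.≤-trans b≤a+2h (ℚ.+-monoˡ-≤ (h ℚ.+ h) a≤d+h))))
  decide : ∀ ε → 0ℚ ℚ.< ½ ℚ.* (½ ℚ.* ε) → Eventually (λ n → seq y n ℚ.≤ seq x n ℚ.+ ε)
  decide ε 0<h with cauchy x _ 0<h | cauchy y _ 0<h
  ... | M , X | N , Y with seq y (M ℕ.⊔ N) ℚ.≤? seq x (M ℕ.⊔ N) ℚ.+ (h ℚ.+ h)
    where
    h = ½ ℚ.* (½ ℚ.* ε)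
  ...   | yes y≤x+2h = K , λ n K≤n → subst (λ e → seq y n ℚ.≤ seq x n ℚ.+ e) 4h≡ε
          (upper (seq x K) (seq y K) (seq y n) (seq x n) _
            (Y n K (ℕ.m⊔n≤o⇒n≤o M N K≤n) (ℕ.m≤n⊔m M N)) y≤x+2h
            (X K n (ℕ.m≤m⊔n M N) (ℕ.m⊔n≤o⇒m≤o M N K≤n)))
    where
    K = M ℕ.⊔ N
    4h≡ε = trans (cong₂ ℚ._+_ (half+half (½ ℚ.* ε)) (half+half (½ ℚ.* ε))) (half+half ε)
  ...   | no y≰x+2h = contradiction x≲y x≰y
    where
    K = M ℕ.⊔ N
    x≲y : x ≲ y
    x≲y = wrap λ δ 0<δ → K , λ n K≤n → ℚ.≤-trans
      (lower (seq x n) (seq x K) (seq y K) (seq y n) _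
        (X n K (ℕ.m⊔n≤o⇒m≤o M N K≤n) (ℕ.m≤m⊔n M N)) y≰x+2h
        (Y K n (ℕ.m≤n⊔m M N) (ℕ.m⊔n≤o⇒n≤o M N K≤n)))
      (≤-+ʳ (ℚ.<⇒≤ 0<δ))

⊔-lub : x ≲ z → y ≲ z → x ⊔ y ≲ z
⊔-lub (wrap x≤z) (wrap y≤z) = wrap λ ε 0<ε →
  eventually-map (λ _ (p , q) → ℚ.⊔-lub p q) (both (x≤z ε 0<ε) (y≤z ε 0<ε))

x≲x⊔y : x ≲ x ⊔ y
x≲x⊔y {x} {y} = wrap λ ε 0<ε → 0 , λ n _ →
  ℚ.≤-trans (ℚ.p≤p⊔q (seq x n) (seq y n)) (≤-+ʳ (ℚ.<⇒≤ 0<ε))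

y≲x⊔y : y ≲ x ⊔ y
y≲x⊔y {y} {x} = wrap λ ε 0<ε → 0 , λ n _ →
  ℚ.≤-trans (ℚ.p≤q⊔p (seq x n) (seq y n)) (≤-+ʳ (ℚ.<⇒≤ 0<ε))

fromℚ-mono : ∀ {p q} → p ℚ.≤ q → fromℚ p ≲ fromℚ q
fromℚ-mono p≤q = wrap λ ε 0<ε → 0 , λ _ _ → ℚ.≤-trans p≤q (≤-+ʳ (ℚ.<⇒≤ 0<ε))

-- Two inequalities instead of `≈`, since early terms of `x` may be 0, where `reciprocal` has the
-- default value 0. The identity holds from the index witnessing `0<x` on.
inverse≃ : ∀ x (0<x : 0ℝ < x) → x * inverse x 0<x ≲ 1ℝ × 1ℝ ≲ x * inverse x 0<x
inverse≃ x 0<x@(δ , 0<δ , N , 0+δ≤x) =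
  wrap (λ ε 0<ε → N , λ n N≤n → ≤-respˡ (sym (one n N≤n)) (≤-+ʳ (ℚ.<⇒≤ 0<ε))) ,
  wrap (λ ε 0<ε → N , λ n N≤n →
    ≤-respʳ (cong (ℚ._+ ε) (sym (one n N≤n))) (≤-+ʳ (ℚ.<⇒≤ 0<ε)))
  where
  one : ∀ n → N ℕ.≤ n → seq x n ℚ.* reciprocal (seq x n) ≡ 1ℚ
  one n N≤n = reciprocal-inverse
    (ℚ.<-≤-trans 0<δ (≤-respˡ (ℚ.+-identityˡ δ) (0+δ≤x n N≤n)))

0≲√ : ∀ x → 0ℝ ≲ √ x
0≲√ x = wrap λ ε 0<ε → 0 , λ n _ → ℚ.≤-trans
  (proj₁ (bisect-spec n (ℚ.p≤q⊔p (seq x n) 0ℚ))) (≤-+ʳ (ℚ.<⇒≤ 0<ε))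

-- Bisection keeps the square of its lower end below max(x, 0), which is eventually at most `x + ε`
-- by the hypothesis.
√-square-≲ : ∀ {x} → 0ℝ ≲ x → √ x * √ x ≲ x
√-square-≲ {x} (wrap 0≤x) = wrap λ ε 0<ε →
  eventually-map
    (λ n 0≤xₙ+ε → ℚ.≤-trans
      (proj₁ (proj₂ (proj₂ (bisect-spec n (ℚ.p≤q⊔p (seq x n) 0ℚ)))))
      (ℚ.⊔-lub (≤-+ʳ {seq x n} (ℚ.<⇒≤ 0<ε)) 0≤xₙ+ε))
    (0≤x ε 0<ε)

-- With `s` and `w` the end and width after n bisections, x ≤ (s + w)² = s² + w (2s + w). As s ≤ S
-- and w ≤ L / (1 + n) for L = 1 + B, the excess over s² is at most L (2S + L) / (1 + n), which
-- tends to 0.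
≲-√-square : ∀ x → x ≲ √ x * √ x
≲-√-square x = wrap approximate
  where
  close : ∀ {s w q S L ε k} → 0ℚ ℚ.≤ s → 0ℚ ℚ.≤ w → 0ℚ ℚ.≤ k → 0ℚ ℚ.≤ L → 0ℚ ℚ.≤ S →
          q ℚ.≤ (s ℚ.+ w) ℚ.* (s ℚ.+ w) → w ℚ.* (1ℚ ℚ.+ k) ℚ.≤ L → s ℚ.≤ S →
          L ℚ.* (S ℚ.+ S ℚ.+ L) ℚ.≤ ε ℚ.* (1ℚ ℚ.+ k) → 0ℚ ℚ.< 1ℚ ℚ.+ k →
          q ℚ.≤ s ℚ.* s ℚ.+ ε
  close {s} {w} {q} {S} {L} {ε} {k} 0≤s 0≤w 0≤k 0≤L 0≤S q≤[s+w]² w[1+k]≤L s≤S small 0<1+k =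
    ℚ.≤-trans q≤[s+w]² (≤-resp
      (solve 2 (λ s w → s :* s :+ w :* (s :+ s :+ w) := (s :+ w) :* (s :+ w)) refl s w)
      refl
      (ℚ.+-monoʳ-≤ (s ℚ.* s) (ℚ.*-cancelʳ-≤-pos (1ℚ ℚ.+ k) ⦃ ℚ.positive 0<1+k ⦄ scaled)))
    where
    w≤L : w ℚ.≤ L
    w≤L = ℚ.≤-trans (≤-respʳ (solve 2 (λ w k → w :+ w :* k := w :* (con 1ℚ :+ k)) refl w k)
            (≤-+ʳ (*-nonNeg 0≤w 0≤k))) w[1+k]≤L
    scaled : w ℚ.* (s ℚ.+ s ℚ.+ w) ℚ.* (1ℚ ℚ.+ k) ℚ.≤ ε ℚ.* (1ℚ ℚ.+ k)
    scaled = ℚ.≤-trans (≤-respˡ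
      (solve 3 (λ s w k → w :* (con 1ℚ :+ k) :* (s :+ s :+ w)
                       := w :* (s :+ s :+ w) :* (con 1ℚ :+ k)) refl s w k)
      (*-mono (*-nonNeg 0≤w (ℚ.<⇒≤ 0<1+k)) (+-nonNeg (+-nonNeg 0≤S 0≤S) 0≤L) w[1+k]≤L
        (ℚ.+-mono-≤ (ℚ.+-mono-≤ s≤S s≤S) w≤L))) small
  approximate : x ≤ √ x * √ x
  approximate ε 0<ε with Convergence.bounded (cauchy (x ⊔ 0ℝ)) | Convergence.bounded (cauchy (√ x))
  ... | B , 0<B , ∣x∣≤B | S , 0<S , ∣√x∣≤S
    with archimedean ((1ℚ ℚ.+ B) ℚ.* (S ℚ.+ S ℚ.+ (1ℚ ℚ.+ B)) ℚ.* reciprocal ε)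
  ...   | K , large =
    eventually-map
      (λ n ((∣x∣≤B , ∣√x∣≤S) , K≤n) →
        let 0≤xₙ = ℚ.p≤q⊔p (seq x n) 0ℚ
            (0≤s , 0≤w , _ , x≤[s+w]²) = bisect-spec n 0≤xₙ
        in close 0≤s 0≤w (0≤ι n) 0≤1+B (ℚ.<⇒≤ 0<S)
             (ℚ.≤-trans (ℚ.p≤p⊔q (seq x n) 0ℚ) x≤[s+w]²)
             (ℚ.≤-trans (bisect-width n 0≤xₙ)
               (ℚ.+-monoʳ-≤ 1ℚ (ℚ.≤-trans (q≤∣q∣ _) ∣x∣≤B)))
             (ℚ.≤-trans (q≤∣q∣ _) ∣√x∣≤S)
             (small n K≤n) (0<1+ι n))
      (both (both ∣x∣≤B ∣√x∣≤S) (K , λ _ K≤n → K≤n))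
    where
    0≤1+B : 0ℚ ℚ.≤ 1ℚ ℚ.+ B
    0≤1+B = +-nonNeg (ℚ.<⇒≤ 0<1) (ℚ.<⇒≤ 0<B)
    small : ∀ n → K ℕ.≤ n → (1ℚ ℚ.+ B) ℚ.* (S ℚ.+ S ℚ.+ (1ℚ ℚ.+ B)) ℚ.≤ ε ℚ.* (1ℚ ℚ.+ ι n)
    small n K≤n = ≤-respˡ (cancel-scaled ((1ℚ ℚ.+ B) ℚ.* (S ℚ.+ S ℚ.+ (1ℚ ℚ.+ B))) 0<ε)
      (*-monoˡ (ℚ.<⇒≤ 0<ε) (ℚ.≤-trans large (ℚ.≤-trans (ι-mono K≤n)
        (≤-respʳ (ℚ.+-comm (ι n) 1ℚ) (≤-+ʳ (ℚ.<⇒≤ 0<1))))))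

-- Termwise ring laws and certificates for polynomial inequalities

≈-refl : x ≈ x
≈-refl = pointwise λ _ → refl

≈-sym : x ≈ y → y ≈ x
≈-sym x≈y = pointwise λ n → sym (at x≈y n)

≈-trans : x ≈ y → y ≈ z → x ≈ z
≈-trans x≈y y≈z = pointwise λ n → trans (at x≈y n) (at y≈z n)

ℝ-commutativeSemiring : CommutativeSemiring _ _
ℝ-commutativeSemiring = record
  { Carrier = ℝ ; _≈_ = _≈_ ; _+_ = _+_ ; _*_ = _*_ ; 0# = 0ℝ ; 1# = 1ℝ
  ; isCommutativeSemiring = record
    { isSemiring = record
      { isSemiringWithoutAnnihilatingZero = record
        { +-isCommutativeMonoid = record
          { isMonoid = record
            { isSemigroup = record
              { isMagma = record
                { isEquivalence = record { refl = ≈-refl ; sym = ≈-sym ; trans = ≈-trans }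
                ; ∙-cong = λ p q → pointwise λ n → cong₂ ℚ._+_ (at p n) (at q n) }
              ; assoc = λ x y z → pointwise λ n → ℚ.+-assoc (seq x n) (seq y n) (seq z n) }
            ; identity = (λ x → pointwise λ n → ℚ.+-identityˡ (seq x n))
                       , (λ x → pointwise λ n → ℚ.+-identityʳ (seq x n)) }
          ; comm = λ x y → pointwise λ n → ℚ.+-comm (seq x n) (seq y n) }
        ; *-cong = λ p q → pointwise λ n → cong₂ ℚ._*_ (at p n) (at q n)
        ; *-assoc = λ x y z → pointwise λ n → ℚ.*-assoc (seq x n) (seq y n) (seq z n)
        ; *-identity = (λ x → pointwise λ n → ℚ.*-identityˡ (seq x n))
                     , (λ x → pointwise λ n → ℚ.*-identityʳ (seq x n))
        ; distrib = (λ x y z → pointwise λ n → ℚ.*-distribˡ-+ (seq x n) (seq y n) (seq z n))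
                  , (λ x y z → pointwise λ n → ℚ.*-distribʳ-+ (seq x n) (seq y n) (seq z n)) }
      ; zero = (λ x → pointwise λ n → ℚ.*-zeroˡ (seq x n))
             , (λ x → pointwise λ n → ℚ.*-zeroʳ (seq x n)) }
    ; *-comm = λ x y → pointwise λ n → ℚ.*-comm (seq x n) (seq y n) } }

≲-preorder : Preorder _ _ _
≲-preorder = record
  { _≈_ = _≈_ ; _≲_ = _≲_
  ; isPreorder = record
    { isEquivalence = CommutativeSemiring.isEquivalence ℝ-commutativeSemiring
    ; reflexive = ≈⇒≲ ; trans = ≲-trans } }

module ≲-Reasoning = Relation.Binary.Reasoning.Preorder ≲-preorder

-- All polynomial inequalities below are certified by a nonnegative combination x ≲ y of known
-- ones for which w - z = y - x is a ring identity; here it is stated without subtraction.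
≲-by : x ≲ y → z + y ≈ w + x → z ≲ w
≲-by {x} {y} {z} {w} (wrap x≤y) z+y≈w+x = wrap λ ε 0<ε → eventually-map
  (λ n x≤y+ε → ≤-resp
    (solve 2 (λ y z → z :+ y :+ :- y := z) refl (seq y n) (seq z n))
    (solve 3 (λ y w ε → w :+ (y :+ ε) :+ :- y := w :+ ε) refl (seq y n) (seq w n) ε)
    (ℚ.+-monoˡ-≤ (ℚ.- seq y n) (ℚ.≤-trans (ℚ.≤-reflexive (at z+y≈w+x n))
      (ℚ.+-monoʳ-≤ (seq w n) x≤y+ε))))
  (x≤y ε 0<ε)

fromℚ≲ : ∀ p q {_ : True (p ℚ.≤? q)} → fromℚ p ≲ fromℚ q
fromℚ≲ p q {p≤q} = fromℚ-mono (toWitness p≤q)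

0≲1 : 0ℝ ≲ 1ℝ
0≲1 = fromℚ≲ 0ℚ 1ℚ

+-nonneg : 0ℝ ≲ x → 0ℝ ≲ y → 0ℝ ≲ x + y
+-nonneg {x} {y} 0≲x 0≲y = ≲-by (+-mono-≲ 0≲x 0≲y) (pointwise λ n →
  solve 2 (λ x y → con 0ℚ :+ (x :+ y) := x :+ y :+ (con 0ℚ :+ con 0ℚ)) refl (seq x n) (seq y n))

*-nonneg : 0ℝ ≲ x → 0ℝ ≲ y → 0ℝ ≲ x * y
*-nonneg {x} {y} 0≲x 0≲y = ≲-by (*-monoˡ-≲ 0≲x 0≲y) (pointwise λ n →
  solve 2 (λ x y → con 0ℚ :+ x :* y := x :* y :+ x :* con 0ℚ) refl (seq x n) (seq y n))

≲-+ʳ : 0ℝ ≲ y → x ≲ x + y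
≲-+ʳ {y} {x} 0≲y = ≲-by 0≲y (pointwise λ n →
  solve 2 (λ x y → x :+ y := x :+ y :+ con 0ℚ) refl (seq x n) (seq y n))

≲-+ˡ : 0ℝ ≲ y → x ≲ y + x
≲-+ˡ {y} {x} 0≲y = ≲-by 0≲y (pointwise λ n →
  solve 2 (λ x y → x :+ y := y :+ x :+ con 0ℚ) refl (seq x n) (seq y n))

*-≳1 : 1ℝ ≲ x → 1ℝ ≲ y → 1ℝ ≲ x * y
*-≳1 {x} {y} 1≲x 1≲y = ≲-by
  (+-mono-≲ (*-monoˡ-≲ (≲-trans 0≲1 1≲x) 1≲y) 1≲x) (pointwise λ n →
  solve 2 (λ x y → con 1ℚ :+ (x :* y :+ x) := x :* y :+ (x :* con 1ℚ :+ con 1ℚ))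
    refl (seq x n) (seq y n))

-- With f s = s² - a s - b, the difference r f(z) - z f(r) factors as (z - r) (z r + b).
quadratic-≲ : ∀ z r a b → 0ℝ ≲ z → 0ℝ ≲ r → 1ℝ ≲ z * r + b →
              z * z ≲ a * z + b → a * r + b ≲ r * r → z ≲ r
quadratic-≲ z r a b 0≲z 0≲r 1≲zr+b zz≲az+b ar+b≲rr = *-cancelʳ-≲ (z * r + b) 1≲zr+b
  (≲-by (+-mono-≲ (*-monoˡ-≲ 0≲r zz≲az+b) (*-monoˡ-≲ 0≲z ar+b≲rr)) (pointwise λ n →
    solve 4 (λ z r a b →
      z :* (z :* r :+ b) :+ (r :* (a :* z :+ b) :+ z :* (r :* r))
      := r :* (z :* r :+ b) :+ (r :* (z :* z) :+ z :* (a :* r :+ b)))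
      refl (seq z n) (seq r n) (seq a n) (seq b n)))

-- The bounds on the terms of the ratio expression by β with denominators cleared, except that
-- the second term is bounded through 1 + 1/α ≤ α and the first one.
record Admissible (α β : ℝ) : Set where
  field
    1≲α        : 1ℝ ≲ α
    2≲β        : 2ℝ ≲ β
    α+1≲αα     : α + 1ℝ ≲ α * α
    α+2≲αβ     : α + 2ℝ ≲ α * β
    α[β+1]≲ββ : α * (β + 1ℝ) ≲ β * β

  0≲α : 0ℝ ≲ α
  0≲α = ≲-trans 0≲1 1≲α

  1≲β : 1ℝ ≲ β
  1≲β = ≲-trans (fromℚ≲ 1ℚ (+ 2 / 1)) 2≲β

  0≲β : 0ℝ ≲ β
  0≲β = ≲-trans 0≲1 1≲β

  -- From α β ≤ α (β + 1) ≤ β², cancelling β.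
  α≲β : α ≲ β
  α≲β = *-cancelʳ-≲ β 1≲β (≲-by (+-mono-≲ α[β+1]≲ββ 0≲α) (pointwise λ n →
    solve 2 (λ α β → α :* β :+ (β :* β :+ α) := β :* β :+ (α :* (β :+ con 1ℚ) :+ con 0ℚ))
      refl (seq α n) (seq β n)))

-- The constants and the ratio expression

private module φ-bounds where

  0≲5 : 0ℝ ≲ 5ℝ
  0≲5 = fromℚ≲ 0ℚ (+ 5 / 1)

  0≲½ : 0ℝ ≲ ½ℝ
  0≲½ = fromℚ≲ 0ℚ ½

  0≲¼ : 0ℝ ≲ fromℚ (+ 1 / 4)
  0≲¼ = fromℚ≲ 0ℚ (+ 1 / 4)

  0≲φ : 0ℝ ≲ φ
  0≲φ = *-nonneg (+-nonneg 0≲1 (0≲√ 5ℝ)) 0≲½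

  -- With r = √5, the difference φ² - φ - 1 is (r² - 5) / 4.
  φφ≲φ+1 : φ * φ ≲ φ + 1ℝ
  φφ≲φ+1 = ≲-by (*-monoˡ-≲ 0≲¼ (√-square-≲ 0≲5)) (pointwise λ n →
    solve 1 (λ r → (con 1ℚ :+ r) :* con ½ :* ((con 1ℚ :+ r) :* con ½)
                     :+ con (+ 1 / 4) :* con (+ 5 / 1)
                := (con 1ℚ :+ r) :* con ½ :+ con 1ℚ :+ con (+ 1 / 4) :* (r :* r))
      refl (seq (√ 5ℝ) n))

  φ+1≲φφ : φ + 1ℝ ≲ φ * φ
  φ+1≲φφ = ≲-by (*-monoˡ-≲ 0≲¼ (≲-√-square 5ℝ)) (pointwise λ n →
    solve 1 (λ r → (con 1ℚ :+ r) :* con ½ :+ con 1ℚ :+ con (+ 1 / 4) :* (r :* r)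
                := (con 1ℚ :+ r) :* con ½ :* ((con 1ℚ :+ r) :* con ½)
                     :+ con (+ 1 / 4) :* con (+ 5 / 1))
      refl (seq (√ 5ℝ) n))

  r : ℝ
  r = √ (5ℝ * φ + 1ℝ)

  0≲5φ+1 : 0ℝ ≲ 5ℝ * φ + 1ℝ
  0≲5φ+1 = +-nonneg (*-nonneg 0≲5 0≲φ) 0≲1

  0≲β* : 0ℝ ≲ β*
  0≲β* = *-nonneg (+-nonneg 0≲φ (0≲√ (5ℝ * φ + 1ℝ))) 0≲½

  -- With r² = 5 φ + 1, the difference β² - φ β - φ is (r² - φ² - 4 φ) / 4, which vanishes by φ² = φ
  -- + 1. So `β*` is a root of s² = φ s + φ, that is, of φ (1 + 1/s) = s.
  ββ≲φβ+φ : β* * β* ≲ φ * β* + φ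
  ββ≲φβ+φ = ≲-by (*-monoˡ-≲ 0≲¼ (+-mono-≲ (√-square-≲ 0≲5φ+1) φ+1≲φφ)) (pointwise λ n →
    solve 2 (λ φ r → (φ :+ r) :* con ½ :* ((φ :+ r) :* con ½)
                       :+ con (+ 1 / 4) :* (con (+ 5 / 1) :* φ :+ con 1ℚ :+ φ :* φ)
                  := φ :* ((φ :+ r) :* con ½) :+ φ
                       :+ con (+ 1 / 4) :* (r :* r :+ (φ :+ con 1ℚ)))
      refl (seq φ n) (seq r n))

  φβ+φ≲ββ : φ * β* + φ ≲ β* * β*
  φβ+φ≲ββ = ≲-by (*-monoˡ-≲ 0≲¼ (+-mono-≲ (≲-√-square (5ℝ * φ + 1ℝ)) φφ≲φ+1)) (pointwise λ n →
    solve 2 (λ φ r → φ :* ((φ :+ r) :* con ½) :+ φ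
                       :+ con (+ 1 / 4) :* (r :* r :+ (φ :+ con 1ℚ))
                  := (φ :+ r) :* con ½ :* ((φ :+ r) :* con ½)
                       :+ con (+ 1 / 4) :* (con (+ 5 / 1) :* φ :+ con 1ℚ :+ φ :* φ))
      refl (seq φ n) (seq r n))

  1·φ+1≲φφ : 1ℝ * φ + 1ℝ ≲ φ * φ
  1·φ+1≲φφ = ≲-by φ+1≲φφ (pointwise λ n →
    solve 1 (λ φ → con 1ℚ :* φ :+ con 1ℚ :+ φ :* φ := φ :* φ :+ (φ :+ con 1ℚ)) refl (seq φ n))

  φφ≲1·φ+1 : φ * φ ≲ 1ℝ * φ + 1ℝ
  φφ≲1·φ+1 = ≲-by φφ≲φ+1 (pointwise λ n →
    solve 1 (λ φ → φ :* φ :+ (φ :+ con 1ℚ) := con 1ℚ :* φ :+ con 1ℚ :+ φ :* φ) refl (seq φ n))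

  φ-lower : fromℚ (+ 161 / 100) ≲ φ
  φ-lower = quadratic-≲ _ φ 1ℝ 1ℝ 0≲q 0≲φ (≲-+ˡ (*-nonneg 0≲q 0≲φ))
    -- The constants here and products of constants have the same terms but different Cauchy proofs.
    -- `_≤_` reads only the terms, so re-wrapping changes the type.
    (wrap (unwrap (fromℚ≲ (q ℚ.* q) (1ℚ ℚ.* q ℚ.+ 1ℚ)))) 1·φ+1≲φφ
    where
    q = + 161 / 100
    0≲q = fromℚ≲ 0ℚ q

  φ-upper : φ ≲ fromℚ (+ 1618034 / 1000000)
  φ-upper = quadratic-≲ φ _ 1ℝ 1ℝ 0≲φ 0≲q (≲-+ˡ (*-nonneg 0≲φ 0≲q))
    φφ≲1·φ+1 (wrap (unwrap (fromℚ≲ (1ℚ ℚ.* q ℚ.+ 1ℚ) (q ℚ.* q))))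
    where
    q = + 1618034 / 1000000
    0≲q = fromℚ≲ 0ℚ q

  1≲φ : 1ℝ ≲ φ
  1≲φ = ≲-trans (fromℚ≲ 1ℚ (+ 161 / 100)) φ-lower

  1≲xy+φ : 0ℝ ≲ x → 0ℝ ≲ y → 1ℝ ≲ x * y + φ
  1≲xy+φ 0≲x 0≲y = ≲-trans 1≲φ (≲-+ˡ (*-nonneg 0≲x 0≲y))

  -- With q = 2.3, q² = 5.29 ≤ 5.313 = 1.61 (q + 1) ≤ φ (q + 1). This coarse bound suffices for
  -- `admissible`.
  β*-lower : fromℚ (+ 23 / 10) ≲ β*
  β*-lower = quadratic-≲ _ β* φ φ 0≲q 0≲β* (1≲xy+φ 0≲q 0≲β*)
    (≲-by (+-mono-≲ (*-monoˡ-≲ 0≲q+1 φ-lower) (fromℚ≲ (q ℚ.* q) (+ 161 / 100 ℚ.* (q ℚ.+ 1ℚ))))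
      (pointwise λ n → solve 1 (λ φ →
          con (q ℚ.* q) :+ (con (q ℚ.+ 1ℚ) :* φ :+ con (+ 161 / 100 ℚ.* (q ℚ.+ 1ℚ)))
          := φ :* con q :+ φ :+ (con (q ℚ.+ 1ℚ) :* con (+ 161 / 100) :+ con (q ℚ.* q)))
        refl (seq φ n)))
    φβ+φ≲ββ
    where
    q = + 23 / 10
    0≲q = fromℚ≲ 0ℚ q
    0≲q+1 = fromℚ≲ 0ℚ (q ℚ.+ 1ℚ)

  -- Here φ (q + 1) ≤ q² is wanted. The margin at q = 2.316513 is about 2 · 10⁻⁶, hence the six
  -- decimals in `φ-upper`.
  β*-upper : β* ≲ fromℚ (+ 2316513 / 1000000)
  β*-upper = quadratic-≲ β* _ φ φ 0≲β* 0≲q (1≲xy+φ 0≲β* 0≲q) ββ≲φβ+φ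
    (≲-by (+-mono-≲ (*-monoˡ-≲ 0≲q+1 φ-upper) (fromℚ≲ (f ℚ.* (q ℚ.+ 1ℚ)) (q ℚ.* q)))
      (pointwise λ n → solve 1 (λ φ →
          φ :* con q :+ φ :+ (con (q ℚ.+ 1ℚ) :* con f :+ con (q ℚ.* q))
          := con (q ℚ.* q) :+ (con (q ℚ.+ 1ℚ) :* φ :+ con (f ℚ.* (q ℚ.+ 1ℚ))))
        refl (seq φ n)))
    where
    f = + 1618034 / 1000000
    q = + 2316513 / 1000000
    0≲q = fromℚ≲ 0ℚ q
    0≲q+1 = fromℚ≲ 0ℚ (q ℚ.+ 1ℚ)

  admissible : Admissible φ β*
  admissible = record
    { 1≲α = 1≲φ
    ; 2≲β = ≲-trans (fromℚ≲ (+ 2 / 1) (+ 23 / 10)) β*-lower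
    ; α+1≲αα = φ+1≲φφ
    -- φ β ≥ 2.3 φ = φ + 1.3 φ, and 1.3 φ ≥ 1.3 · 1.61 ≥ 2.
    ; α+2≲αβ = ≲-by
        (+-mono-≲ (*-monoˡ-≲ 0≲φ β*-lower)
          (+-mono-≲ (*-monoˡ-≲ (fromℚ≲ 0ℚ (+ 13 / 10)) φ-lower)
            (fromℚ≲ (+ 2 / 1) (+ 13 / 10 ℚ.* (+ 161 / 100)))))
        (pointwise λ n → solve 2 (λ φ β →
            φ :+ con (+ 2 / 1)
              :+ (φ :* β :+ (con (+ 13 / 10) :* φ :+ con (+ 13 / 10 ℚ.* (+ 161 / 100))))
            := φ :* β :+ (φ :* con (+ 23 / 10)
              :+ (con (+ 13 / 10) :* con (+ 161 / 100) :+ con (+ 2 / 1))))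
          refl (seq φ n) (seq β* n))
    ; α[β+1]≲ββ = ≲-by φβ+φ≲ββ (pointwise λ n →
        solve 2 (λ φ β → φ :* (β :+ con 1ℚ) :+ β :* β := β :* β :+ (φ :* β :+ φ))
          refl (seq φ n) (seq β* n))
    }

open φ-bounds using (0≲φ; 1≲φ; φφ≲φ+1; 0≲β*; ββ≲φβ+φ; β*-upper; admissible)

module _ (α β : ℝ) (1≤α : 1ℝ ≤ α) (1≤β : 1ℝ ≤ β) where

  private
    1≲α : 1ℝ ≲ α
    1≲α = wrap 1≤α

    1≲β : 1ℝ ≲ β
    1≲β = wrap 1≤β

    0≲α : 0ℝ ≲ α
    0≲α = ≲-trans 0≲1 1≲α

    0≲β : 0ℝ ≲ β
    0≲β = ≲-trans 0≲1 1≲β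

    αβ = α * β
    1/α = inverse α (1≤⇒0< α 1≤α)
    1/β = inverse β (1≤⇒0< β 1≤β)
    1/αβ = inverse αβ (*-pos α β (1≤⇒0< α 1≤α) (1≤⇒0< β 1≤β))

    α/α≲1 = proj₁ (inverse≃ α (1≤⇒0< α 1≤α))
    1≲α/α = proj₂ (inverse≃ α (1≤⇒0< α 1≤α))
    β/β≲1 = proj₁ (inverse≃ β (1≤⇒0< β 1≤β))
    1≲β/β = proj₂ (inverse≃ β (1≤⇒0< β 1≤β))
    αβ/αβ≲1 = proj₁ (inverse≃ αβ (*-pos α β (1≤⇒0< α 1≤α) (1≤⇒0< β 1≤β)))
    1≲αβ/αβ = proj₂ (inverse≃ αβ (*-pos α β (1≤⇒0< α 1≤α) (1≤⇒0< β 1≤β)))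

  ratio-≲ : Admissible α β → ratio α β 1≤α 1≤β ≲ β
  ratio-≲ adm = ⊔-lub (⊔-lub (⊔-lub (⊔-lub first second) ≲-refl) 2≲β) fifth
    where
    open Admissible adm using (2≲β; α+1≲αα; α+2≲αβ; α[β+1]≲ββ)
    first : α * (1ℝ + 1/β) ≲ β
    first = *-cancelʳ-≲ β 1≲β (≲-by (+-mono-≲ (*-monoˡ-≲ 0≲α β/β≲1) α[β+1]≲ββ)
      (pointwise λ n → solve 3 (λ α β y →
          α :* (con 1ℚ :+ y) :* β :+ (α :* con 1ℚ :+ β :* β)
          := β :* β :+ (α :* (β :* y) :+ α :* (β :+ con 1ℚ)))
        refl (seq α n) (seq β n) (seq 1/β n)))
    -- Multiplied by α β, the left side is (α + 1) (β + 1) ≤ α² (β + 1) ≤ α β².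
    second : 1ℝ + 1/α + 1/β + 1/αβ ≲ β
    second = *-cancelʳ-≲ αβ (*-≳1 1≲α 1≲β) (≲-by
      (+-mono-≲ (+-mono-≲ (*-monoˡ-≲ 0≲β α/α≲1) (*-monoˡ-≲ 0≲α β/β≲1))
        (+-mono-≲ αβ/αβ≲1 (+-mono-≲
          (*-monoˡ-≲ (+-nonneg 0≲β 0≲1) α+1≲αα) (*-monoˡ-≲ 0≲α α[β+1]≲ββ))))
      (pointwise λ n → solve 5 (λ α β x y z →
          (con 1ℚ :+ x :+ y :+ z) :* (α :* β)
            :+ (β :* con 1ℚ :+ α :* con 1ℚ
              :+ (con 1ℚ :+ ((β :+ con 1ℚ) :* (α :* α) :+ α :* (β :* β))))
          := β :* (α :* β)
            :+ (β :* (α :* x) :+ α :* (β :* y)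
              :+ (α :* β :* z :+ ((β :+ con 1ℚ) :* (α :+ con 1ℚ) :+ α :* (α :* (β :+ con 1ℚ))))))
        refl (seq α n) (seq β n) (seq 1/α n) (seq 1/β n) (seq 1/αβ n)))
    fifth : 1ℝ + 2ℝ * 1/α ≲ β
    fifth = *-cancelʳ-≲ α 1≲α (≲-by
      (+-mono-≲ (*-monoˡ-≲ (fromℚ≲ 0ℚ (+ 2 / 1)) α/α≲1) α+2≲αβ)
      (pointwise λ n → solve 3 (λ α β x →
          (con 1ℚ :+ con (+ 2 / 1) :* x) :* α :+ (con (+ 2 / 1) :* con 1ℚ :+ α :* β)
          := β :* α :+ (con (+ 2 / 1) :* (α :* x) :+ (α :+ con (+ 2 / 1))))
        refl (seq α n) (seq β n) (seq 1/α n)))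

  -- With ρ the ratio, the first two terms and β ≤ ρ give ρ² ≥ max(α, 1 + 1/α) (ρ + 1), so
  -- s = ρ² / (ρ + 1) has s² ≥ s + 1, that is s ≥ φ.
  ≲-ratio : β* ≲ ratio α β 1≤α 1≤β
  ≲-ratio = quadratic-≲ β* ρ φ φ 0≲β* 0≲ρ (≲-trans 1≲φ (≲-+ˡ (*-nonneg 0≲β* 0≲ρ))) ββ≲φβ+φ
    (≲-by φP≲Q (pointwise λ n →
      solve 2 (λ φ ρ → φ :* ρ :+ φ :+ ρ :* ρ := ρ :* ρ :+ φ :* (ρ :+ con 1ℚ))
        refl (seq φ n) (seq ρ n)))
    where
    ρ P Q : ℝ
    ρ = ratio α β 1≤α 1≤β
    P = ρ + 1ℝ
    Q = ρ * ρ
    first : α * (1ℝ + 1/β) ≲ ρ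
    first = ≲-trans x≲x⊔y (≲-trans x≲x⊔y (≲-trans x≲x⊔y x≲x⊔y))
    second : 1ℝ + 1/α + 1/β + 1/αβ ≲ ρ
    second = ≲-trans y≲x⊔y (≲-trans x≲x⊔y (≲-trans x≲x⊔y x≲x⊔y))
    third : β ≲ ρ
    third = ≲-trans y≲x⊔y (≲-trans x≲x⊔y x≲x⊔y)
    0≲ρ : 0ℝ ≲ ρ
    0≲ρ = ≲-trans 0≲β third
    0≲1/β : 0ℝ ≲ 1/β
    0≲1/β = *-cancelʳ-≲ β 1≲β (≲-by (+-mono-≲ 0≲1 1≲β/β) (pointwise λ n →
      solve 2 (λ β y → con 0ℚ :* β :+ (con 1ℚ :+ β :* y) := y :* β :+ (con 0ℚ :+ con 1ℚ))
        refl (seq β n) (seq 1/β n)))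
    0≲1/αβ : 0ℝ ≲ 1/αβ
    0≲1/αβ = *-cancelʳ-≲ αβ (*-≳1 1≲α 1≲β) (≲-by (+-mono-≲ 0≲1 1≲αβ/αβ) (pointwise λ n →
      solve 2 (λ β y → con 0ℚ :* β :+ (con 1ℚ :+ β :* y) := y :* β :+ (con 0ℚ :+ con 1ℚ))
        refl (seq αβ n) (seq 1/αβ n)))
    -- ρ² ≥ ρ α (1 + 1/β) = α ρ + α ρ / β ≥ α ρ + α, the last step by ρ ≥ β.
    αP≲Q : α * P ≲ Q
    αP≲Q = ≲-by
      (+-mono-≲ (*-monoˡ-≲ 0≲ρ first)
        (+-mono-≲ (*-monoˡ-≲ (*-nonneg 0≲α 0≲1/β) third) (*-monoˡ-≲ 0≲α 1≲β/β)))
      (pointwise λ n → solve 4 (λ α β y ρ →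
          α :* (ρ :+ con 1ℚ) :+ (ρ :* ρ :+ (α :* y :* ρ :+ α :* (β :* y)))
          := ρ :* ρ :+ (ρ :* (α :* (con 1ℚ :+ y)) :+ (α :* y :* β :+ α :* con 1ℚ)))
        refl (seq α n) (seq β n) (seq 1/β n) (seq ρ n))
    -- In the same way α ρ² is at least α ρ times the second term, α ρ + ρ + α ρ / β + ρ / β, and
    -- the last two summands are at least α and 1.
    [α+1]P≲αQ : (α + 1ℝ) * P ≲ α * Q
    [α+1]P≲αQ = ≲-by
      (+-mono-≲ (*-monoˡ-≲ (*-nonneg 0≲α 0≲ρ) second)
        (+-mono-≲ (*-monoˡ-≲ 0≲ρ 1≲α/α)
          (+-mono-≲
            (+-mono-≲ (*-monoˡ-≲ (*-nonneg 0≲α 0≲1/β) third) (*-monoˡ-≲ 0≲α 1≲β/β))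
            (+-mono-≲ (*-monoˡ-≲ (*-nonneg 0≲α 0≲1/αβ) third) 1≲αβ/αβ))))
      (pointwise λ n → solve 6 (λ α β x y z ρ →
          (α :+ con 1ℚ) :* (ρ :+ con 1ℚ)
            :+ (α :* ρ :* ρ :+ (ρ :* (α :* x)
              :+ (α :* y :* ρ :+ α :* (β :* y) :+ (α :* z :* ρ :+ α :* β :* z))))
          := α :* (ρ :* ρ)
            :+ (α :* ρ :* (con 1ℚ :+ x :+ y :+ z) :+ (ρ :* con 1ℚ
              :+ (α :* y :* β :+ α :* con 1ℚ :+ (α :* z :* β :+ con 1ℚ)))))
        refl (seq α n) (seq β n) (seq 1/α n) (seq 1/β n) (seq 1/αβ n) (seq ρ n))
    0≲P : 0ℝ ≲ P
    0≲P = +-nonneg 0≲ρ 0≲1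
    P≲Q : P ≲ Q
    P≲Q = *-cancelʳ-≲ α 1≲α (≲-by (+-mono-≲ [α+1]P≲αQ 0≲P) (pointwise λ n →
      solve 3 (λ α P Q →
          P :* α :+ (α :* Q :+ P) := Q :* α :+ ((α :+ con 1ℚ) :* P :+ con 0ℚ))
        refl (seq α n) (seq P n) (seq Q n)))
    Q-P : ℝ
    Q-P = Q + fromℚ (ℚ.- 1ℚ) * P
    0≲Q-P : 0ℝ ≲ Q-P
    0≲Q-P = ≲-by P≲Q (pointwise λ n →
      solve 2 (λ P Q → con 0ℚ :+ Q := Q :+ con (ℚ.- 1ℚ) :* P :+ P) refl (seq P n) (seq Q n))
    -- The multipliers Q - P and P are chosen so that α cancels in the sum of the two bounds.
    PQ+PP≲QQ : P * Q + P * P ≲ Q * Q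
    PQ+PP≲QQ = ≲-by (+-mono-≲ (*-monoˡ-≲ 0≲Q-P αP≲Q) (*-monoˡ-≲ 0≲P [α+1]P≲αQ))
      (pointwise λ n → solve 3 (λ α P Q →
          P :* Q :+ P :* P :+ ((Q :+ con (ℚ.- 1ℚ) :* P) :* Q :+ P :* (α :* Q))
          := Q :* Q :+ ((Q :+ con (ℚ.- 1ℚ) :* P) :* (α :* P) :+ P :* ((α :+ con 1ℚ) :* P)))
        refl (seq α n) (seq P n) (seq Q n))
    φP≲Q : φ * P ≲ Q
    -- The inequality s² ≥ s + 1 for s = Q / P is used in homogeneous form, which avoids the
    -- division: φ P satisfies z² ≤ P z + P².
    φP≲Q = quadratic-≲ (φ * P) Q P (P * P) (*-nonneg 0≲φ 0≲P) (*-nonneg 0≲ρ 0≲ρ)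
      (≲-trans (*-≳1 (≲-+ˡ 0≲ρ) (≲-+ˡ 0≲ρ))
        (≲-+ˡ (*-nonneg (*-nonneg 0≲φ 0≲P) (*-nonneg 0≲ρ 0≲ρ))))
      (≲-by (*-monoˡ-≲ (*-nonneg 0≲P 0≲P) φφ≲φ+1) (pointwise λ n →
        solve 2 (λ φ P → φ :* P :* (φ :* P) :+ P :* P :* (φ :+ con 1ℚ)
                      := P :* (φ :* P) :+ P :* P :+ P :* P :* (φ :* φ))
          refl (seq φ n) (seq P n)))
      PQ+PP≲QQ

-- Finite sums and double sums of reals

open CommutativeSemiring ℝ-commutativeSemiring
  using (semiring; setoid; +-cong; +-congˡ; *-congˡ; *-congʳ; distribˡ)
open import Algebra.Properties.Semiring.Sum semiring
  using (sum; sum-replicate-zero; sum-cong-≋; ∑-distrib-+; ∑-comm; *-distribˡ-sum; *-distribʳ-sum)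

∑∑ : ∀ {m} → (Fin m → Fin m → ℝ) → ℝ
∑∑ f = sum (λ i → sum (f i))

sum-mono : ∀ {m} {f g : Fin m → ℝ} → (∀ i → f i ≲ g i) → sum f ≲ sum g
sum-mono {zero}  f≲g = ≲-refl
sum-mono {suc m} f≲g = +-mono-≲ (f≲g zero) (sum-mono (λ i → f≲g (suc i)))

only : ∀ {m} → Fin m → ℝ → Fin m → ℝ
only i x j = if does (i ≟ j) then x else 0ℝ

sum-only : ∀ {m} (i : Fin m) x → sum (only i x) ≈ x
sum-only {suc m} zero x = ≈-trans (+-congˡ (sum-replicate-zero m))
  (pointwise λ n → ℚ.+-identityʳ (seq x n))
sum-only (suc i) x = ≈-trans (+-congˡ (sum-only i x))
  (pointwise λ n → ℚ.+-identityˡ (seq x n))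

∑∑-product : ∀ {m} (v c : Fin m → ℝ) f →
             ∑∑ (λ i j → v i * c j + f i j) ≈ sum v * sum c + ∑∑ f
∑∑-product v c f = begin
  ∑∑ (λ i j → v i * c j + f i j)
    ≈⟨ sum-cong-≋ (λ i → ∑-distrib-+ (λ j → v i * c j) (f i)) ⟩
  sum (λ i → sum (λ j → v i * c j) + sum (f i))
    ≈⟨ ∑-distrib-+ (λ i → sum (λ j → v i * c j)) (λ i → sum (f i)) ⟩
  sum (λ i → sum (λ j → v i * c j)) + ∑∑ f
    ≈⟨ +-cong (sum-cong-≋ (λ i → ≈-sym (*-distribˡ-sum (v i) c))) ≈-refl ⟩
  sum (λ i → v i * sum c) + ∑∑ f
    ≈⟨ +-cong (≈-sym (*-distribʳ-sum (sum c) v)) ≈-refl ⟩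
  sum v * sum c + ∑∑ f ∎
  where open import Relation.Binary.Reasoning.Setoid setoid

∑∑-symmetrise : ∀ {m} (f : Fin m → Fin m → ℝ) →
                ∑∑ (λ i j → f i j + f j i) ≈ ∑∑ f + ∑∑ f
∑∑-symmetrise f = begin
  ∑∑ (λ i j → f i j + f j i)
    ≈⟨ sum-cong-≋ (λ i → ∑-distrib-+ (f i) (λ j → f j i)) ⟩
  sum (λ i → sum (f i) + sum (λ j → f j i))
    ≈⟨ ∑-distrib-+ (λ i → sum (f i)) (λ i → sum (λ j → f j i)) ⟩
  ∑∑ f + ∑∑ (λ i j → f j i)
    ≈⟨ +-congˡ (∑-comm (λ i j → f j i)) ⟩
  ∑∑ f + ∑∑ f ∎
  where open import Relation.Binary.Reasoning.Setoid setoid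

∑∑-mono : ∀ {m} {f g : Fin m → Fin m → ℝ} → (∀ i j → f i j ≲ g i j) → ∑∑ f ≲ ∑∑ g
∑∑-mono f≲g = sum-mono (λ i → sum-mono (f≲g i))

∑∑-* : ∀ {m} c (f : Fin m → Fin m → ℝ) → ∑∑ (λ i j → c * f i j) ≈ c * ∑∑ f
∑∑-* c f = ≈-trans (sum-cong-≋ (λ i → ≈-sym (*-distribˡ-sum c (f i))))
                   (≈-sym (*-distribˡ-sum c (λ i → sum (f i))))

-- Single ordered pairs of jobs need not compare well, only the two orders together. Symmetrising
-- doubles both double sums, and the factor 2 is cancelled.
∑∑-≲-symmetric : ∀ {m c} {f g : Fin m → Fin m → ℝ} →
                 (∀ i j → f i j + f j i ≲ c * (g i j + g j i)) → ∑∑ f ≲ c * ∑∑ g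
∑∑-≲-symmetric {c = c} {f} {g} sym-≲ = *-cancelʳ-≲ 2ℝ (fromℚ≲ 1ℚ (+ 2 / 1))
  (≲-by
    (≲-trans (≲-trans (≈⇒≲ (≈-sym (∑∑-symmetrise f))) (∑∑-mono sym-≲))
      (≈⇒≲ (≈-trans (∑∑-* c (λ i j → g i j + g j i)) (*-congˡ (∑∑-symmetrise g)))))
    (pointwise λ n → solve 3 (λ c f g →
        f :* con (+ 2 / 1) :+ c :* (g :+ g) := c :* g :* con (+ 2 / 1) :+ (f :+ f))
      refl (seq c n) (seq (∑∑ f) n) (seq (∑∑ g) n)))

-- Cost as mutual delay of pairs of jobs

completion : Kind → ℝ
completion testing            = 0ℝ
completion execution          = 1ℝ
completion execution-untested = 1ℝ

completions : List Kind → ℝ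
completions []       = 0ℝ
completions (k ∷ ks) = completion k + completions ks

-- The non-empty lists of tasks that can remain of one job in a feasible schedule.
data Pending : List Kind → Set where
  untested : Pending (execution-untested ∷ [])
  tested   : Pending (execution ∷ [])
  untried  : Pending (testing ∷ execution ∷ [])

completions-pending : ∀ {ks} → Pending ks → completions ks ≈ 1ℝ
completions-pending untested = pointwise λ _ → refl
completions-pending tested   = pointwise λ _ → refl
completions-pending untried  = pointwise λ _ → refl

module _ {m : ℕ} where

  tasksOf-same : ∀ (j : Fin m) k S → tasksOf j (task j k ∷ S) ≡ k ∷ tasksOf j S
  tasksOf-same j k S with j ≟ j
  ... | yes _  = refl
  ... | no j≢j = contradiction refl j≢j

  tasksOf-other : ∀ {i j : Fin m} k S → i ≢ j → tasksOf j (task i k ∷ S) ≡ tasksOf j S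
  tasksOf-other {i} {j} k S i≢j with i ≟ j
  ... | yes i≡j = contradiction i≡j i≢j
  ... | no _    = refl

  only-same : ∀ (i : Fin m) x → only i x i ≡ x
  only-same i x with i ≟ i
  ... | yes _  = refl
  ... | no i≢i = contradiction refl i≢i

  only-other : ∀ {i j : Fin m} x → i ≢ j → only i x j ≡ 0ℝ
  only-other {i} {j} x i≢j with i ≟ j
  ... | yes i≡j = contradiction i≡j i≢j
  ... | no _    = refl

  completions-task : ∀ (i j : Fin m) k S →
    completions (tasksOf j (task i k ∷ S)) ≈ only i (completion k) j + completions (tasksOf j S)
  completions-task i j k S with i ≟ j
  ... | yes _ = ≈-refl
  ... | no _  = pointwise λ n → sym (ℚ.+-identityˡ (seq (completions (tasksOf j S)) n))

module Delay (I : Instance) where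

  open Instance I using (t; u; p; 0≤t; 0≤u; 0≤p; p≤u)

  private
    m = Instance.n I

  0≲t : ∀ j → 0ℝ ≲ t j
  0≲t j = wrap (0≤t j)

  0≲u : ∀ j → 0ℝ ≲ u j
  0≲u j = wrap (0≤u j)

  0≲p : ∀ j → 0ℝ ≲ p j
  0≲p j = wrap (0≤p j)

  p≲u : ∀ j → p j ≲ u j
  p≲u j = wrap (p≤u j)

  duration-nonneg : ∀ a → 0ℝ ≲ duration I a
  duration-nonneg (task j testing)            = 0≲t j
  duration-nonneg (task j execution)          = 0≲p j
  duration-nonneg (task j execution-untested) = 0≲u j
  duration-nonneg (idle d 0≤d)                = wrap 0≤d

  work : Action m → Fin m → ℝ
  work a@(task i k) j = only i (duration I a) j
  work (idle d _)   j = 0ℝ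

  -- The work done on i before a completion of j, summed over all completions of j.
  delay : Schedule m → Fin m → Fin m → ℝ
  delay []      i j = 0ℝ
  delay (a ∷ S) i j = work a i * completions (tasksOf j (a ∷ S)) + delay S i j

  mutualDelay : Schedule m → Fin m → Fin m → ℝ
  mutualDelay S i j = delay S i j + delay S j i

  totalCompletions : Schedule m → ℝ
  totalCompletions S = sum (λ j → completions (tasksOf j S))

  idleDelay : Schedule m → ℝ
  idleDelay []               = 0ℝ
  idleDelay (task _ _ ∷ S)   = idleDelay S
  idleDelay (idle d 0≤d ∷ S) = d * totalCompletions S + idleDelay S

  totalCompletions-task : ∀ i k S →
    totalCompletions (task i k ∷ S) ≈ completion k + totalCompletions S
  totalCompletions-task i k S = ≈-trans
    (sum-cong-≋ (λ j → completions-task i j k S))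
    (≈-trans (∑-distrib-+ (only i (completion k)) (λ j → completions (tasksOf j S)))
      (+-cong (sum-only i (completion k)) ≈-refl))

  costFrom-task : ∀ now i k S → let d = duration I (task i k) in
    costFrom I now (task i k ∷ S) ≈ completion k * (now + d) + costFrom I (now + d) S
  costFrom-task now i testing S = pointwise λ n →
    solve 2 (λ x c → c := con 0ℚ :* x :+ c) refl
      (seq (now + t i) n) (seq (costFrom I (now + t i) S) n)
  costFrom-task now i execution S = pointwise λ n →
    solve 2 (λ x c → x :+ c := con 1ℚ :* x :+ c) refl
      (seq (now + p i) n) (seq (costFrom I (now + p i) S) n)
  costFrom-task now i execution-untested S = pointwise λ n →
    solve 2 (λ x c → x :+ c := con 1ℚ :* x :+ c) refl
      (seq (now + u i) n) (seq (costFrom I (now + u i) S) n)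

  -- The start time shifts every completion. Each action shifts all completions of the schedule that
  -- begins with it, its own included, by its duration; this is booked under a pair of jobs or, when
  -- idling, under `idleDelay`.
  costFrom-delays : ∀ now S →
    costFrom I now S ≈ now * totalCompletions S + (idleDelay S + ∑∑ (delay S))
  costFrom-delays now [] = ≈-sym (begin
    now * sum {m} (λ _ → 0ℝ) + (0ℝ + ∑∑ {m} (λ _ _ → 0ℝ))
      ≈⟨ +-cong (*-congˡ (sum-replicate-zero m))
           (+-congˡ (≈-trans (sum-cong-≋ {m} (λ _ → sum-replicate-zero m))
                             (sum-replicate-zero m))) ⟩
    now * 0ℝ + (0ℝ + 0ℝ)
      ≈⟨ (pointwise λ n →
           solve 1 (λ x → x :* con 0ℚ :+ (con 0ℚ :+ con 0ℚ) := con 0ℚ) refl (seq now n)) ⟩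
    0ℝ ∎)
    where open import Relation.Binary.Reasoning.Setoid setoid
  costFrom-delays now (a@(task i k) ∷ S) = begin
    costFrom I now (a ∷ S)
      ≈⟨ costFrom-task now i k S ⟩
    completion k * (now + d) + costFrom I (now + d) S
      ≈⟨ +-congˡ (costFrom-delays (now + d) S) ⟩
    completion k * (now + d) + ((now + d) * C + (idleDelay S + ∑∑ (delay S)))
      ≈⟨ (pointwise λ n → solve 6 (λ c now d C x y →
             c :* (now :+ d) :+ ((now :+ d) :* C :+ (x :+ y))
             := now :* (c :+ C) :+ (x :+ (d :* (c :+ C) :+ y)))
           refl (seq (completion k) n) (seq now n) (seq d n) (seq C n)
             (seq (idleDelay S) n) (seq (∑∑ (delay S)) n)) ⟩
    now * (completion k + C) + (idleDelay S + (d * (completion k + C) + ∑∑ (delay S)))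
      ≈⟨ +-cong (*-congˡ (≈-sym C'≈))
           (+-congˡ (+-cong
             (≈-trans (*-congˡ (≈-sym C'≈)) (*-congʳ (≈-sym (sum-only i d)))) ≈-refl)) ⟩
    now * totalCompletions (a ∷ S)
      + (idleDelay S + (sum (work a) * totalCompletions (a ∷ S) + ∑∑ (delay S)))
      ≈⟨ +-congˡ (+-congˡ (≈-sym
           (∑∑-product (work a) (λ j → completions (tasksOf j (a ∷ S))) (delay S)))) ⟩
    now * totalCompletions (a ∷ S) + (idleDelay (a ∷ S) + ∑∑ (delay (a ∷ S))) ∎
    where
    open import Relation.Binary.Reasoning.Setoid setoid
    d = duration I a
    C = totalCompletions S
    C'≈ = totalCompletions-task i k S
  costFrom-delays now (a@(idle d 0≤d) ∷ S) = begin
    costFrom I (now + d) S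
      ≈⟨ costFrom-delays (now + d) S ⟩
    (now + d) * C + (idleDelay S + ∑∑ (delay S))
      ≈⟨ (pointwise λ n → solve 5 (λ now d C x y →
             (now :+ d) :* C :+ (x :+ y) := now :* C :+ (d :* C :+ x :+ (con 0ℚ :* C :+ y)))
           refl (seq now n) (seq d n) (seq C n) (seq (idleDelay S) n) (seq (∑∑ (delay S)) n)) ⟩
    now * C + (idleDelay (a ∷ S) + (0ℝ * C + ∑∑ (delay S)))
      ≈⟨ +-congˡ (+-congˡ (+-cong (*-congʳ (≈-sym (sum-replicate-zero m))) ≈-refl)) ⟩
    now * C + (idleDelay (a ∷ S) + (sum {m} (λ _ → 0ℝ) * C + ∑∑ (delay S)))
      ≈⟨ +-congˡ (+-congˡ (≈-sym
           (∑∑-product (λ _ → 0ℝ) (λ j → completions (tasksOf j S)) (delay S)))) ⟩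
    now * C + (idleDelay (a ∷ S) + ∑∑ (delay (a ∷ S))) ∎
    where
    open import Relation.Binary.Reasoning.Setoid setoid
    C = totalCompletions S

  cost-delays : ∀ S → cost I S ≈ idleDelay S + ∑∑ (delay S)
  cost-delays S = ≈-trans (costFrom-delays 0ℝ S) (pointwise λ n →
    solve 2 (λ c x → con 0ℚ :* c :+ x := x) refl
      (seq (totalCompletions S) n) (seq (idleDelay S + ∑∑ (delay S)) n))

  completions-nonneg : ∀ ks → 0ℝ ≲ completions ks
  completions-nonneg []                        = ≲-refl
  completions-nonneg (testing ∷ ks)            = +-nonneg ≲-refl (completions-nonneg ks)
  completions-nonneg (execution ∷ ks)          = +-nonneg 0≲1 (completions-nonneg ks)
  completions-nonneg (execution-untested ∷ ks) = +-nonneg 0≲1 (completions-nonneg ks)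

  sum-nonneg : ∀ {l} {f : Fin l → ℝ} → (∀ i → 0ℝ ≲ f i) → 0ℝ ≲ sum f
  sum-nonneg {zero}  0≲f = ≲-refl
  sum-nonneg {suc l} 0≲f = +-nonneg (0≲f zero) (sum-nonneg (λ i → 0≲f (suc i)))

  idleDelay-nonneg : ∀ S → 0ℝ ≲ idleDelay S
  idleDelay-nonneg []               = ≲-refl
  idleDelay-nonneg (task _ _ ∷ S)   = idleDelay-nonneg S
  idleDelay-nonneg (idle d 0≤d ∷ S) = +-nonneg
    (*-nonneg (wrap 0≤d) (sum-nonneg (λ j → completions-nonneg (tasksOf j S)))) (idleDelay-nonneg S)

  work-nonneg : ∀ a i → 0ℝ ≲ work a i
  work-nonneg (idle _ _) i = ≲-refl
  work-nonneg a@(task i' k) i with i' ≟ i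
  ... | yes _ = duration-nonneg a
  ... | no _  = ≲-refl

  delay-nonneg : ∀ S i j → 0ℝ ≲ delay S i j
  delay-nonneg []      i j = ≲-refl
  delay-nonneg (a ∷ S) i j = +-nonneg
    (*-nonneg (work-nonneg a i) (completions-nonneg (tasksOf j (a ∷ S)))) (delay-nonneg S i j)

  data Concerns (j : Fin m) : Action m → Set where
    own     : ∀ k → Concerns j (task j k)
    foreign : ∀ {a} → (∀ S → tasksOf j (a ∷ S) ≡ tasksOf j S) → work a j ≡ 0ℝ → Concerns j a

  concerns : ∀ j a → Concerns j a
  concerns j (idle _ _) = foreign (λ _ → refl) refl
  concerns j (task i k) with i ≟ j
  ... | yes refl = own k
  ... | no i≢j   = foreign (λ S → tasksOf-other k S i≢j) (only-other _ i≢j)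

  mutualDelay-own : ∀ {i j} k S → i ≢ j →
    mutualDelay (task i k ∷ S) i j
      ≈ duration I (task i k) * completions (tasksOf j S) + mutualDelay S i j
  mutualDelay-own {i} {j} k S i≢j = expand (only-same i _) (only-other _ i≢j)
    (cong completions (tasksOf-other k S i≢j))
    where
    expand : ∀ {v v' d c c' e x y} → v ≡ d → v' ≡ 0ℝ → c ≡ c' →
             v * c + x + (v' * e + y) ≈ d * c' + (x + y)
    expand {d = d} {c = c} {e = e} {x} {y} refl refl refl = pointwise λ n →
      solve 5 (λ d c e x y → d :* c :+ x :+ (con 0ℚ :* e :+ y) := d :* c :+ (x :+ y)) refl
        (seq d n) (seq c n) (seq e n) (seq x n) (seq y n)

  mutualDelay-foreign : ∀ {i j} a S → work a i ≡ 0ℝ → work a j ≡ 0ℝ →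
    mutualDelay (a ∷ S) i j ≈ mutualDelay S i j
  mutualDelay-foreign a S = expand
    where
    expand : ∀ {v v' c e x y} → v ≡ 0ℝ → v' ≡ 0ℝ → v * c + x + (v' * e + y) ≈ x + y
    expand {c = c} {e} {x} {y} refl refl = pointwise λ n →
      solve 4 (λ c e x y → con 0ℚ :* c :+ x :+ (con 0ℚ :* e :+ y) := x :+ y) refl
        (seq c n) (seq e n) (seq x n) (seq y n)

  mutualDelay-comm : ∀ S i j → mutualDelay S i j ≈ mutualDelay S j i
  mutualDelay-comm S i j = pointwise λ n → ℚ.+-comm (seq (delay S i j) n) (seq (delay S j i) n)

  mutualDelay-pending : ∀ {i j} k S → i ≢ j → Pending (tasksOf j S) →
    mutualDelay (task i k ∷ S) i j ≈ duration I (task i k) + mutualDelay S i j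
  mutualDelay-pending {i} {j} k S i≢j pending = ≈-trans (mutualDelay-own k S i≢j)
    (+-cong (≈-trans (*-congˡ (completions-pending pending))
      (pointwise λ n → ℚ.*-identityʳ (seq (duration I (task i k)) n))) ≈-refl)

  -- Without tasks of i there is neither work on i nor a completion of i that work on j could delay.
  mutualDelay-finished : ∀ S {i j} → i ≢ j → tasksOf i S ≡ [] → mutualDelay S i j ≈ 0ℝ
  mutualDelay-finished []      i≢j none = pointwise λ _ → refl
  mutualDelay-finished (a ∷ S) {i} {j} i≢j none with concerns i a | concerns j a
  ... | own k | _ = contradiction (trans (sym (tasksOf-same i k S)) none) λ ()
  ... | foreign skip v≡0 | foreign _ v'≡0 =
    ≈-trans (mutualDelay-foreign a S v≡0 v'≡0)
            (mutualDelay-finished S i≢j (trans (sym (skip S)) none))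
  ... | foreign skip _ | own k = begin
    mutualDelay (task j k ∷ S) i j
      ≈⟨ mutualDelay-comm (task j k ∷ S) i j ⟩
    mutualDelay (task j k ∷ S) j i
      ≈⟨ mutualDelay-own k S (λ j≡i → i≢j (sym j≡i)) ⟩
    duration I (task j k) * completions (tasksOf i S) + mutualDelay S j i
      ≈⟨ +-cong (*-congˡ (≡⇒≈ (cong completions rest)))
           (≈-trans (mutualDelay-comm S j i) (mutualDelay-finished S i≢j rest)) ⟩
    duration I (task j k) * 0ℝ + 0ℝ
      ≈⟨ (pointwise λ n → solve 1 (λ d → d :* con 0ℚ :+ con 0ℚ := con 0ℚ) refl
           (seq (duration I (task j k)) n)) ⟩
    0ℝ ∎
    where
    open import Relation.Binary.Reasoning.Setoid setoid
    rest = trans (sym (skip S)) none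
    ≡⇒≈ : ∀ {x y} → x ≡ y → x ≈ y
    ≡⇒≈ refl = ≈-refl

  workload : Fin m → List Kind → ℝ
  workload i []       = 0ℝ
  workload i (k ∷ ks) = duration I (task i k) + workload i ks

  -- Whichever of the two jobs is completed first has all its work delaying the other one.
  workload-≲-mutualDelay : ∀ O {i j ks ls} → i ≢ j →
    tasksOf i O ≡ ks → Pending ks → tasksOf j O ≡ ls → Pending ls →
    (workload i ks ≲ mutualDelay O i j) ⊎ (workload j ls ≲ mutualDelay O i j)
  -- The case that the next relevant task belongs to i, separated so that symmetry covers j as well.
  workload-≲-first : ∀ O {i j k ks ls} → i ≢ j →
    tasksOf i O ≡ ks → Pending (k ∷ ks) → tasksOf j O ≡ ls → Pending ls →
    (workload i (k ∷ ks) ≲ mutualDelay (task i k ∷ O) i j)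
    ⊎ (workload j ls ≲ mutualDelay (task i k ∷ O) i j)

  workload-≲-mutualDelay [] i≢j refl ()
  workload-≲-mutualDelay (a ∷ O) {i} {j} i≢j eᵢ Pᵢ eⱼ Pⱼ with concerns i a | concerns j a
  ... | own k | own .k = contradiction refl i≢j
  ... | foreign skipᵢ v≡0 | foreign skipⱼ v'≡0 = Sum.map rebase rebase
      (workload-≲-mutualDelay O i≢j
        (trans (sym (skipᵢ O)) eᵢ) Pᵢ (trans (sym (skipⱼ O)) eⱼ) Pⱼ)
    where
    rebase : ∀ {x} → x ≲ mutualDelay O i j → x ≲ mutualDelay (a ∷ O) i j
    rebase x≲D = ≲-trans x≲D (≈⇒≲ (≈-sym (mutualDelay-foreign a O v≡0 v'≡0)))
  ... | own k | foreign skip _ with trans (sym (tasksOf-same i k O)) eᵢ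
  ...   | refl = workload-≲-first O i≢j refl Pᵢ (trans (sym (skip O)) eⱼ) Pⱼ
  workload-≲-mutualDelay (a ∷ O) {i} {j} i≢j eᵢ Pᵢ eⱼ Pⱼ
      | foreign skip _ | own k with trans (sym (tasksOf-same j k O)) eⱼ
  ...   | refl = Sum.swap (Sum.map rebase rebase
      (workload-≲-first O (λ j≡i → i≢j (sym j≡i)) refl Pⱼ (trans (sym (skip O)) eᵢ) Pᵢ))
    where
    rebase : ∀ {x} → x ≲ mutualDelay (a ∷ O) j i → x ≲ mutualDelay (a ∷ O) i j
    rebase x≲D = ≲-trans x≲D (≈⇒≲ (mutualDelay-comm (a ∷ O) j i))

  workload-≲-first O {i} {j} {k} {ks} {ls} i≢j eᵢ Pᵢ refl Pⱼ = Sum.map rebase rebase (bound Pᵢ)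
    where
    d = duration I (task i k)
    0≲D = +-nonneg (delay-nonneg O i j) (delay-nonneg O j i)
    rebase : ∀ {x} → x ≲ d + mutualDelay O i j → x ≲ mutualDelay (task i k ∷ O) i j
    rebase x≲D = ≲-trans x≲D (≈⇒≲ (≈-sym (mutualDelay-pending k O i≢j Pⱼ)))
    bound : Pending (k ∷ ks) → (workload i (k ∷ ks) ≲ d + mutualDelay O i j)
                             ⊎ (workload j ls ≲ d + mutualDelay O i j)
    bound untested = inj₁ (+-mono-≲ ≲-refl 0≲D)
    bound tested   = inj₁ (+-mono-≲ ≲-refl 0≲D)
    -- After the test of i the induction applies to its execution alone; if i wins, the test time
    -- completes its workload, and if j wins, the test only adds to the delay.
    bound untried  = Sum.map
      (+-mono-≲ ≲-refl)
      (λ x≲D → ≲-trans x≲D (≲-+ˡ (duration-nonneg (task i k))))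
      (workload-≲-mutualDelay O i≢j eᵢ tested refl Pⱼ)

  selfDelay : Fin m → List Kind → ℝ
  selfDelay i []       = 0ℝ
  selfDelay i (k ∷ ks) = duration I (task i k) * completions (k ∷ ks) + selfDelay i ks

  delay-self : ∀ S j → delay S j j ≈ selfDelay j (tasksOf j S)
  delay-self []      j = ≈-refl
  delay-self (a ∷ S) j with concerns j a
  ... | own k = own-case (only-same j _) (tasksOf-same j k S)
    where
    own-case : ∀ {v ks} → v ≡ duration I (task j k) → ks ≡ k ∷ tasksOf j S →
               v * completions ks + delay S j j ≈ selfDelay j ks
    own-case refl refl = +-congˡ (delay-self S j)
  ... | foreign skip v≡0 = foreign-case v≡0 (skip S)
    where
    foreign-case : ∀ {v c ks} → v ≡ 0ℝ → ks ≡ tasksOf j S → v * c + delay S j j ≈ selfDelay j ks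
    foreign-case {c = c} refl refl = ≈-trans
      (pointwise λ n → solve 2 (λ c x → con 0ℚ :* c :+ x := x) refl (seq c n) (seq (delay S j j) n))
      (delay-self S j)

  selfDelay-pending : ∀ j {ks} → Pending ks → selfDelay j ks ≈ workload j ks
  selfDelay-pending j untested = pointwise λ n → cong (ℚ._+ 0ℚ) (ℚ.*-identityʳ (seq (u j) n))
  selfDelay-pending j tested   = pointwise λ n → cong (ℚ._+ 0ℚ) (ℚ.*-identityʳ (seq (p j) n))
  selfDelay-pending j untried  = +-cong (pointwise λ n → ℚ.*-identityʳ (seq (t j) n))
    (selfDelay-pending j tested)

  -- The diagonal of the double sum: all tasks of a job precede or include its single completion.
  delay-self-workload : ∀ S j {ks} → tasksOf j S ≡ ks → Pending ks → delay S j j ≈ workload j ks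
  delay-self-workload S j refl pending = ≈-trans (delay-self S j) (selfDelay-pending j pending)

-- Competitive analysis

module Competitive (α β : ℝ) (adm : Admissible α β) (I : Instance) where

  open Admissible adm
  open Instance I using (t; u; p)
  open Delay I

  private
    m = Instance.n I

  weight : Fin m → Kind → ℝ
  weight j testing            = β * t j
  weight j execution          = t j + p j
  weight j execution-untested = u j

  -- The queue entries of one job along a run

  belongs? : ∀ j (e : (Fin m × Kind) × ℝ) → Dec (proj₁ (proj₁ e) ≡ j)
  belongs? j e = proj₁ (proj₁ e) ≟ j

  entries : Fin m → Queue I → Queue I
  entries j = filter (belongs? j)

  -- Stated through the filtered queue, this also says that the job has a single entry, and it
  -- transfers along permutations.
  Waiting : Fin m → Kind → Queue I → Set
  Waiting j k Q = entries j Q ≡ ((j , k) , weight j k) ∷ []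

  private variable
    i j : Fin m
    k k' : Kind
    v : ℝ
    Q R : Queue I
    S : Schedule m
    d qᵢ qⱼ q A τ : ℝ

  data Extracted (j : Fin m) (k : Kind) (R : Queue I) : (Fin m × Kind) × ℝ → Set where
    own     : entries j R ≡ [] → Extracted j k R ((j , k) , weight j k)
    foreign : ∀ {i k' v} → i ≢ j → Waiting j k R → Extracted j k R ((i , k') , v)

  -- Filtering both sides of the permutation by j leaves a permutation of a singleton, hence an
  -- equality of lists.
  extract : Waiting j k Q → Q ↭ ((i , k') , v) ∷ R → Extracted j k R ((i , k') , v)
  extract {j} {k} {Q} {i} {k'} {v} {R} waiting Q↭ = split (↭-singleton-inv
      (↭-sym (subst (_↭ entries j (((i , k') , v) ∷ R)) waiting (filter-↭ (belongs? j) Q↭))))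
    where
    split : Waiting j k (((i , k') , v) ∷ R) → Extracted j k R ((i , k') , v)
    split eq with i ≟ j
    ... | no i≢j = foreign i≢j eq
    ... | yes _ with ∷-injective eq
    ...   | refl , absent = own absent

  absent-extract : entries j Q ≡ [] → Q ↭ ((i , k) , v) ∷ R → i ≢ j × entries j R ≡ []
  absent-extract {j} {Q} {i} {k} {v} {R} absent Q↭ = split (↭-empty-inv
      (↭-sym (subst (_↭ entries j (((i , k) , v) ∷ R)) absent (filter-↭ (belongs? j) Q↭))))
    where
    split : entries j (((i , k) , v) ∷ R) ≡ [] → i ≢ j × entries j R ≡ []
    split eq with i ≟ j
    split () | yes _
    split eq | no i≢j = i≢j , eq

  entries-followUp : ∀ k → i ≢ j → entries j (followUp I (i , k) ++ R) ≡ entries j R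
  entries-followUp testing            i≢j = filter-reject (belongs? _) i≢j
  entries-followUp execution          i≢j = refl
  entries-followUp execution-untested i≢j = refl

  waiting-tested : entries j R ≡ [] → Waiting j execution (followUp I (j , testing) ++ R)
  waiting-tested {j} absent =
    trans (filter-accept (belongs? j) refl) (cong (_ ∷_) absent)

  agenda : Kind → List Kind
  agenda testing            = testing ∷ execution ∷ []
  agenda execution          = execution ∷ []
  agenda execution-untested = execution-untested ∷ []

  agenda-pending : ∀ k → Pending (agenda k)
  agenda-pending testing            = untried
  agenda-pending execution          = tested
  agenda-pending execution-untested = untested

  absent-tasks : entries j Q ≡ [] → Run I Q S → tasksOf j S ≡ []
  absent-tasks absent done = refl
  absent-tasks absent (step {k = k} Q↭ _ run) with absent-extract absent Q↭
  ... | i≢j , absent' =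
    trans (tasksOf-other k _ i≢j) (absent-tasks (trans (entries-followUp k i≢j) absent') run)

  waiting-tasks : Waiting j k Q → Run I Q S → tasksOf j S ≡ agenda k
  waiting-tasks {j} waiting (step {k = k'} Q↭ _ run) with extract waiting Q↭
  ... | foreign i≢j waiting' =
    trans (tasksOf-other k' _ i≢j) (waiting-tasks (trans (entries-followUp k' i≢j) waiting') run)
  waiting-tasks {j} {testing} waiting (step Q↭ _ run) | own absent =
    trans (tasksOf-same j testing _) (cong (testing ∷_) (waiting-tasks (waiting-tested absent) run))
  waiting-tasks {j} {execution} waiting (step Q↭ _ run) | own absent =
    trans (tasksOf-same j execution _) (cong (execution ∷_) (absent-tasks absent run))
  waiting-tasks {j} {execution-untested} waiting (step Q↭ _ run) | own absent =
    trans (tasksOf-same j execution-untested _)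
          (cong (execution-untested ∷_) (absent-tasks absent run))

  idleDelay-run : Run I Q S → idleDelay S ≡ 0ℝ
  idleDelay-run done           = refl
  idleDelay-run (step _ _ run) = idleDelay-run run

  -- How a run treats two jobs i and j whose next tasks have the given kinds; the last index
  -- is their mutual delay.
  data Race (i j : Fin m) : Kind → Kind → ℝ → Set where
    finishˡ : k ≢ testing → weight i k ≲ weight j k' → Race i j k k' (duration I (task i k))
    finishʳ : k' ≢ testing → weight j k' ≲ weight i k → Race i j k k' (duration I (task j k'))
    testˡ   : weight i testing ≲ weight j k' → Race i j execution k' d →
              Race i j testing k' (t i + d)
    testʳ   : weight j testing ≲ weight i k → Race i j k execution d →
              Race i j k testing (t j + d)

  swapRace : Race i j k k' d → Race j i k' k d
  swapRace (finishˡ k≢t w≲w') = finishʳ k≢t w≲w'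
  swapRace (finishʳ k≢t w≲w') = finishˡ k≢t w≲w'
  swapRace (testˡ w≲w' race)  = testʳ w≲w' (swapRace race)
  swapRace (testʳ w≲w' race)  = testˡ w≲w' (swapRace race)

  smallest : Waiting j k R → All (λ e → v ≤ proj₂ e) R → v ≲ weight j k
  smallest waiting v≤R with subst (All _) waiting (All.filter⁺ (belongs? _) v≤R)
  ... | v≤w ∷ _ = wrap v≤w

  mutualDelay-finish : ∀ k → i ≢ j → Waiting j k' Q → Run I Q S → tasksOf i S ≡ [] →
    mutualDelay (task i k ∷ S) i j ≈ duration I (task i k)
  mutualDelay-finish {k' = k'} {S = S} k i≢j waiting run finished = ≈-trans
    (mutualDelay-pending k S i≢j
      (subst Pending (sym (waiting-tasks waiting run)) (agenda-pending k')))
    (≈-trans (+-congˡ (mutualDelay-finished S i≢j finished))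
      (pointwise λ n → ℚ.+-identityʳ (seq (duration I (task _ k)) n)))

  -- Tasks of third jobs leave the mutual delay unchanged, so the run is followed to the first
  -- extraction concerning i or j, and `race-first` continues from there. The weight comparison is
  -- the minimality of the extracted entry.
  race : i ≢ j → Waiting i k Q → Waiting j k' Q → Run I Q S →
         ∃[ d ] (Race i j k k' d × mutualDelay S i j ≈ d)
  race-first : i ≢ j → entries i R ≡ [] → Waiting j k' R → weight i k ≲ weight j k' →
               Run I (followUp I (i , k) ++ R) S →
               ∃[ d ] (Race i j k k' d × mutualDelay (task i k ∷ S) i j ≈ d)

  race i≢j wᵢ wⱼ (step {j = l} {k = k} {S = S} Q↭ least run) with extract wᵢ Q↭ | extract wⱼ Q↭
  ... | own _ | own _ = contradiction refl i≢j
  ... | own absent | foreign _ wⱼ' = race-first i≢j absent wⱼ' (smallest wⱼ' least) run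
  ... | foreign l≢i wᵢ' | foreign l≢j wⱼ' with race i≢j
          (trans (entries-followUp k l≢i) wᵢ') (trans (entries-followUp k l≢j) wⱼ') run
  ...   | d , r , D≈d = d , r ,
          ≈-trans (mutualDelay-foreign (task l k) S (only-other _ l≢i) (only-other _ l≢j)) D≈d
  race {i} {j} i≢j wᵢ wⱼ (step {k = k} {S = S} Q↭ least run)
      | foreign _ wᵢ' | own absent
      with race-first (λ j≡i → i≢j (sym j≡i)) absent wᵢ' (smallest wᵢ' least) run
  ...   | d , r , D≈d = d , swapRace r , ≈-trans (mutualDelay-comm (task j k ∷ S) i j) D≈d

  -- The test delays the one outstanding completion of j, so `t i` is added once and the race goes
  -- on with the execution of i.
  race-first {i} {j} {k' = k'} {k = testing} {S = S} i≢j absent wⱼ w≲w' run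
    with waiting ← trans (entries-followUp testing i≢j) wⱼ
    with race i≢j (waiting-tested absent) waiting run
  ... | d , r , D≈d = t i + d , testˡ w≲w' r , ≈-trans
    (mutualDelay-pending testing S i≢j
      (subst Pending (sym (waiting-tasks waiting run)) (agenda-pending k')))
    (+-congˡ D≈d)
  race-first {k = execution} i≢j absent wⱼ w≲w' run =
    _ , finishˡ (λ ()) w≲w' , mutualDelay-finish execution i≢j wⱼ run (absent-tasks absent run)
  race-first {k = execution-untested} i≢j absent wⱼ w≲w' run =
    _ , finishˡ (λ ()) w≲w' ,
    mutualDelay-finish execution-untested i≢j wⱼ run (absent-tasks absent run)

  -- The initial queue

  Start : Fin m → Kind → Set
  Start j k = Initial I α β j ((j , k) , weight j k)

  absent-initially : ∀ {js} → All (j ≢_) js → Pointwise (Initial I α β) js Q → entries j Q ≡ []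
  absent-initially [] [] = refl
  absent-initially (j≢i ∷ j∉js) (test _ ∷ rest) =
    trans (filter-reject (belongs? _) (λ i≡j → j≢i (sym i≡j))) (absent-initially j∉js rest)
  absent-initially (j≢i ∷ j∉js) (no-test _ ∷ rest) =
    trans (filter-reject (belongs? _) (λ i≡j → j≢i (sym i≡j))) (absent-initially j∉js rest)

  waiting-initially : ∀ {js} → Unique js → j ∈ js → Pointwise (Initial I α β) js Q →
                      ∃[ k ] (Start j k × Waiting j k Q)
  waiting-initially {j} (j∉js ∷ _) (here refl) (test αt≤u ∷ rest) =
    testing , test αt≤u ,
    trans (filter-accept (belongs? j) refl) (cong (_ ∷_) (absent-initially j∉js rest))
  waiting-initially {j} (j∉js ∷ _) (here refl) (no-test αt≰u ∷ rest) =
    execution-untested , no-test αt≰u ,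
    trans (filter-accept (belongs? j) refl) (cong (_ ∷_) (absent-initially j∉js rest))
  waiting-initially (i∉js ∷ unique) (there j∈js) (test _ ∷ rest)
    with k , start , waiting ← waiting-initially unique j∈js rest =
    k , start , trans (filter-reject (belongs? _) (All.lookup i∉js j∈js)) waiting
  waiting-initially (i∉js ∷ unique) (there j∈js) (no-test _ ∷ rest)
    with k , start , waiting ← waiting-initially unique j∈js rest =
    k , start , trans (filter-reject (belongs? _) (All.lookup i∉js j∈js)) waiting

  -- Differs from `weight` only at `testing`, so weight comparisons involving executions are
  -- comparisons of total times by definition.
  total : Fin m → Kind → ℝ
  total j testing            = t j + p j
  total j execution          = t j + p j
  total j execution-untested = u j

  -- What the competitive analysis needs about job j when PCP starts it with a task of kind k
  -- and a competing schedule spends time q on it.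
  record Comparison (j : Fin m) (k : Kind) (q : ℝ) : Set where
    field
      0≲q       : 0ℝ ≲ q
      total≲αq  : total j k ≲ α * q
      test≲q    : k ≡ testing → t j ≲ q
      retest≲βq : k ≡ testing → t j + total j k ≲ β * q

  -- A tested job has t ≤ u/α and p ≤ u. If q ≥ u, then t + p ≤ (1 + 1/α) q ≤ α q and 2t + p ≤ (1 +
  -- 2/α) q ≤ β q; if q ≥ t + p, then 2t + p ≤ 2q ≤ β q. An untested job has u ≤ α t, which settles
  -- q ≥ t + p.
  compare : Start j k → (u j ≲ q) ⊎ (t j + p j ≲ q) → Comparison j k q
  compare {j} {q = q} (test αt≤u) (inj₁ u≲q) = record
    { 0≲q = 0≲q
    ; total≲αq = *-cancelʳ-≲ α 1≲α (≲-by
        (+-mono-≲ (+-mono-≲ αt≲u (*-monoˡ-≲ 0≲α (p≲u j)))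
          (+-mono-≲ (*-monoˡ-≲ (+-nonneg 0≲α 0≲1) u≲q) (*-monoˡ-≲ 0≲q α+1≲αα)))
        (pointwise λ n → solve 5 (λ α t p u q →
            (t :+ p) :* α :+ (u :+ α :* u :+ ((α :+ con 1ℚ) :* q :+ q :* (α :* α)))
            := α :* q :* α
              :+ (α :* t :+ α :* p :+ ((α :+ con 1ℚ) :* u :+ q :* (α :+ con 1ℚ))))
          refl (seq α n) (seq (t j) n) (seq (p j) n) (seq (u j) n) (seq q n)))
    ; test≲q = λ _ → ≲-by
        (+-mono-≲ (*-monoˡ-≲ (0≲t j) 1≲α) (+-mono-≲ αt≲u u≲q))
        (pointwise λ n → solve 4 (λ α t u q →
            t :+ (t :* α :+ (u :+ q)) := q :+ (t :* con 1ℚ :+ (α :* t :+ u)))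
          refl (seq α n) (seq (t j) n) (seq (u j) n) (seq q n))
    ; retest≲βq = λ _ → *-cancelʳ-≲ α 1≲α (≲-by
        (+-mono-≲
          (+-mono-≲ (*-monoˡ-≲ 0≲2 αt≲u) (*-monoˡ-≲ 0≲α (p≲u j)))
          (+-mono-≲ (*-monoˡ-≲ (+-nonneg 0≲α 0≲2) u≲q) (*-monoˡ-≲ 0≲q α+2≲αβ)))
        (pointwise λ n → solve 6 (λ α β t p u q →
            (t :+ (t :+ p)) :* α
              :+ (con (+ 2 / 1) :* u :+ α :* u :+ ((α :+ con (+ 2 / 1)) :* q :+ q :* (α :* β)))
            := β :* q :* α
              :+ (con (+ 2 / 1) :* (α :* t) :+ α :* p
                :+ ((α :+ con (+ 2 / 1)) :* u :+ q :* (α :+ con (+ 2 / 1)))))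
          refl (seq α n) (seq β n) (seq (t j) n) (seq (p j) n) (seq (u j) n) (seq q n)))
    }
    where
    αt≲u : α * t j ≲ u j
    αt≲u = wrap αt≤u
    0≲2 : 0ℝ ≲ 2ℝ
    0≲2 = fromℚ≲ 0ℚ (+ 2 / 1)
    0≲q = ≲-trans (0≲u j) u≲q
  compare {j} {q = q} (test αt≤u) (inj₂ t+p≲q) = record
    { 0≲q = 0≲q
    ; total≲αq = ≲-by (+-mono-≲ t+p≲q (*-monoˡ-≲ 0≲q 1≲α)) (pointwise λ n →
        solve 3 (λ α x q → x :+ (q :+ q :* α) := α :* q :+ (x :+ q :* con 1ℚ))
          refl (seq α n) (seq (t j + p j) n) (seq q n))
    ; test≲q = λ _ → t≲q
    ; retest≲βq = λ _ → ≲-by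
        (+-mono-≲ (+-mono-≲ t≲q t+p≲q) (*-monoˡ-≲ 0≲q 2≲β))
        (pointwise λ n → solve 4 (λ β t x q →
            t :+ x :+ (q :+ q :+ q :* β) := β :* q :+ (t :+ x :+ q :* con (+ 2 / 1)))
          refl (seq β n) (seq (t j) n) (seq (t j + p j) n) (seq q n))
    }
    where
    t≲q = ≲-trans (≲-+ʳ (0≲p j)) t+p≲q
    0≲q = ≲-trans (0≲t j) t≲q
  compare {j} {q = q} (no-test αt≰u) served = record
    { 0≲q = 0≲q served
    ; total≲αq = total≲αq served
    ; test≲q = λ ()
    ; retest≲βq = λ ()
    }
    where
    0≲q : (u j ≲ q) ⊎ (t j + p j ≲ q) → 0ℝ ≲ q
    0≲q (inj₁ u≲q)   = ≲-trans (0≲u j) u≲q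
    0≲q (inj₂ t+p≲q) = ≲-trans (+-nonneg (0≲t j) (0≲p j)) t+p≲q
    total≲αq : (u j ≲ q) ⊎ (t j + p j ≲ q) → u j ≲ α * q
    total≲αq (inj₁ u≲q) = ≲-by (+-mono-≲ u≲q (*-monoˡ-≲ (0≲q (inj₁ u≲q)) 1≲α))
      (pointwise λ n → solve 3 (λ α u q → u :+ (q :+ q :* α) := α :* q :+ (u :+ q :* con 1ℚ))
        refl (seq α n) (seq (u j) n) (seq q n))
    total≲αq (inj₂ t+p≲q) = ≲-trans (≰⇒≳ λ αt≲u → αt≰u (unwrap αt≲u))
      (*-monoˡ-≲ 0≲α (≲-trans (≲-+ʳ (0≲p j)) t+p≲q))

  -- Bounds on the delay of a race

  αq≲βq : 0ℝ ≲ q → A ≲ α * q → A ≲ β * q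
  αq≲βq {q} {A} 0≲q A≲αq = ≲-by (+-mono-≲ A≲αq (*-monoˡ-≲ 0≲q α≲β)) (pointwise λ n →
    solve 4 (λ α β q A → A :+ (α :* q :+ q :* β) := β :* q :+ (A :+ q :* α))
      refl (seq α n) (seq β n) (seq q n) (seq A n))

  -- `τ` is a test of the other job run earlier: β (τ + A) ≤ (β + 1) A ≤ (β + 1) α q ≤ β² q.
  interposed : 0ℝ ≲ q → β * τ ≲ A → A ≲ α * q → τ + A ≲ β * q
  interposed {q} {τ} {A} 0≲q βτ≲A A≲αq = *-cancelʳ-≲ β 1≲β (≲-by
    (+-mono-≲ βτ≲A
      (+-mono-≲ (*-monoˡ-≲ (+-nonneg 0≲β 0≲1) A≲αq) (*-monoˡ-≲ 0≲q α[β+1]≲ββ)))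
    (pointwise λ n → solve 5 (λ α β τ A q →
        (τ :+ A) :* β :+ (A :+ ((β :+ con 1ℚ) :* (α :* q) :+ q :* (β :* β)))
        := β :* q :* β :+ (β :* τ :+ ((β :+ con 1ℚ) :* A :+ q :* (α :* (β :+ con 1ℚ)))))
      refl (seq α n) (seq β n) (seq τ n) (seq A n) (seq q n)))

  βt-cancel : β * x ≲ β * y → x ≲ y
  βt-cancel {x} {y} βx≲βy = *-cancelʳ-≲ β 1≲β (≲-by βx≲βy (pointwise λ n →
    solve 3 (λ β x y → x :* β :+ β :* y := y :* β :+ β :* x) refl (seq β n) (seq x n) (seq y n)))

  module _ {i j : Fin m} {k k' : Kind} {qᵢ qⱼ : ℝ}
           (cᵢ : Comparison i k qᵢ) (cⱼ : Comparison j k' qⱼ) where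

    private
      module Cᵢ = Comparison cᵢ
      module Cⱼ = Comparison cⱼ

    -- Here i is completed before j is touched. Towards j, the weight bounding `total i k` is β tⱼ ≤
    -- β qⱼ if j is tested, and uⱼ ≤ α qⱼ otherwise.
    uninterrupted : Start j k' → total i k ≲ weight j k' → total i k ≲ β * qᵢ × total i k ≲ β * qⱼ
    uninterrupted (test _) Aᵢ≲w = αq≲βq Cᵢ.0≲q Cᵢ.total≲αq ,
      ≲-trans Aᵢ≲w (*-monoˡ-≲ 0≲β (Cⱼ.test≲q refl))
    uninterrupted (no-test _) Aᵢ≲w = αq≲βq Cᵢ.0≲q Cᵢ.total≲αq ,
      αq≲βq Cⱼ.0≲q (≲-trans Aᵢ≲w Cⱼ.total≲αq)

    -- Here i is tested, but j is completed first. `interposed` applies with A the total of j, which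
    -- is at most α qⱼ and, through the total of i, at most α qᵢ.
    overtaken : β * t i ≲ total j k' → total j k' ≲ total i k →
                t i + total j k' ≲ β * qᵢ × t i + total j k' ≲ β * qⱼ
    overtaken βtᵢ≲Aⱼ Aⱼ≲Aᵢ = interposed Cᵢ.0≲q βtᵢ≲Aⱼ (≲-trans Aⱼ≲Aᵢ Cᵢ.total≲αq) ,
      interposed Cⱼ.0≲q βtᵢ≲Aⱼ Cⱼ.total≲αq

    Bounded : ℝ → Set
    Bounded d = d ≲ β * qᵢ × d ≲ β * qⱼ

    -- Both tests come first, that of i before that of j. Raising the total of j to that of i, or tᵢ
    -- to tⱼ, gives a test time plus the total of the same job.
    nested : k ≡ testing → k' ≡ testing → t i ≲ t j → total j k' ≲ total i k →
             Bounded (t i + total j k')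
    nested k≡t k'≡t tᵢ≲tⱼ Aⱼ≲Aᵢ =
      ≲-trans (+-mono-≲ ≲-refl Aⱼ≲Aᵢ) (Cᵢ.retest≲βq k≡t) ,
      ≲-trans (+-mono-≲ tᵢ≲tⱼ ≲-refl) (Cⱼ.retest≲βq k'≡t)

    finish-bounded : Start i k → Start j k' → k ≢ testing → weight i k ≲ weight j k' →
                     Bounded (duration I (task i k))
    finish-bounded (test _)    _  k≢t w≲w' = contradiction refl k≢t
    finish-bounded (no-test _) sⱼ _   w≲w' = uninterrupted sⱼ w≲w'

  module _ {i j : Fin m} {qᵢ qⱼ : ℝ} where

    test-bounded : Start i testing → Start j k' →
                   Comparison i testing qᵢ → Comparison j k' qⱼ →
                   weight i testing ≲ weight j k' → Race i j execution k' d →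
                   t i + d ≲ β * qᵢ × t i + d ≲ β * qⱼ
    test-bounded sᵢ sⱼ cᵢ cⱼ w≲w' (finishˡ _ Aᵢ≲w') = uninterrupted cᵢ cⱼ sⱼ Aᵢ≲w'
    test-bounded sᵢ (test _) cᵢ cⱼ w≲w' (finishʳ k'≢t _) = contradiction refl k'≢t
    test-bounded sᵢ sⱼ@(no-test _) cᵢ cⱼ w≲w' (finishʳ _ w'≲Aᵢ) = overtaken cᵢ cⱼ w≲w' w'≲Aᵢ
    -- Both tests precede the execution of i: the delay tᵢ + tⱼ + pᵢ is tⱼ plus the total of i, so i
    -- overtakes j.
    test-bounded sᵢ sⱼ cᵢ cⱼ w≲w' (testʳ w'≲Aᵢ (finishˡ _ Aᵢ≲Aⱼ)) =
      Product.map (≲-trans exchange) (≲-trans exchange)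
        (Product.swap (overtaken cⱼ cᵢ w'≲Aᵢ Aᵢ≲Aⱼ))
      where
      exchange : t i + (t j + p i) ≲ t j + (t i + p i)
      exchange = ≈⇒≲ (pointwise λ n →
        solve 3 (λ x y z → x :+ (y :+ z) := y :+ (x :+ z)) refl
          (seq (t i) n) (seq (t j) n) (seq (p i) n))
    test-bounded sᵢ sⱼ cᵢ cⱼ w≲w' (testʳ w'≲Aᵢ (finishʳ _ Aⱼ≲Aᵢ)) =
      nested cᵢ cⱼ refl refl (βt-cancel w≲w') Aⱼ≲Aᵢ

  race-bounded : Start i k → Start j k' → Comparison i k qᵢ → Comparison j k' qⱼ →
                 Race i j k k' d → d ≲ β * qᵢ × d ≲ β * qⱼ
  race-bounded sᵢ sⱼ cᵢ cⱼ (finishˡ k≢t w≲w')  = finish-bounded cᵢ cⱼ sᵢ sⱼ k≢t w≲w'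
  race-bounded sᵢ sⱼ cᵢ cⱼ (finishʳ k'≢t w'≲w) =
    Product.swap (finish-bounded cⱼ cᵢ sⱼ sᵢ k'≢t w'≲w)
  race-bounded sᵢ sⱼ cᵢ cⱼ (testˡ w≲w' r)      = test-bounded sᵢ sⱼ cᵢ cⱼ w≲w' r
  race-bounded sᵢ sⱼ cᵢ cⱼ (testʳ w'≲w r)      =
    Product.swap (test-bounded sⱼ sᵢ cⱼ cᵢ w'≲w (swapRace r))

  -- Summation over all pairs of jobs

  workload-agenda : Start j k → workload j (agenda k) ≈ total j k
  workload-agenda {j} (test _) = +-congˡ (pointwise λ n → ℚ.+-identityʳ (seq (p j) n))
  workload-agenda {j} (no-test _) = pointwise λ n → ℚ.+-identityʳ (seq (u j) n)

  feasible-pending : ∀ {ks} → (ks ≡ execution-untested ∷ []) ⊎ (ks ≡ testing ∷ execution ∷ []) →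
    Pending ks × ((u j ≲ workload j ks) ⊎ (t j + p j ≲ workload j ks))
  feasible-pending (inj₁ refl) = untested , inj₁ (≲-+ʳ ≲-refl)
  feasible-pending (inj₂ refl) = untried , inj₂ (+-mono-≲ ≲-refl (≲-+ʳ ≲-refl))

  pcp-competitive : ∀ S → PCP α β I S → ∀ O → Feasible O → cost I S ≲ β * cost I O
  pcp-competitive S (Q , initial , run) O feasible = begin
    cost I S
      ≈⟨ cost-delays S ⟩
    idleDelay S + ∑∑ (delay S)
      ≈⟨ no-idle (idleDelay-run run) ⟩
    ∑∑ (delay S)
      ≲⟨ ∑∑-≲-symmetric pairwise ⟩
    β * ∑∑ (delay O)
      ≲⟨ *-monoˡ-≲ 0≲β (≲-+ˡ (idleDelay-nonneg O)) ⟩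
    β * (idleDelay O + ∑∑ (delay O))
      ≈⟨ *-congˡ (≈-sym (cost-delays O)) ⟩
    β * cost I O ∎
    where
    open ≲-Reasoning
    no-idle : ∀ {x y} → x ≡ 0ℝ → x + y ≈ y
    no-idle {y = y} refl = pointwise λ n → ℚ.+-identityˡ (seq y n)
    load : Fin m → ℝ
    load j = workload j (tasksOf j O)
    module Job (j : Fin m) where
      initially = waiting-initially (allFin⁺ m) (∈-allFin j) initial
      kind : Kind
      kind = proj₁ initially
      started : Start j kind
      started = proj₁ (proj₂ initially)
      waiting : Waiting j kind Q
      waiting = proj₂ (proj₂ initially)
      pending : Pending (tasksOf j O)
      pending = proj₁ (feasible-pending {j} (feasible j))
      comparison : Comparison j kind (load j)
      comparison = compare started (proj₂ (feasible-pending {j} (feasible j)))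
    self : ∀ i → delay S i i ≲ β * delay O i i
    self i = begin
      delay S i i
        ≈⟨ delay-self-workload S i (waiting-tasks waiting run) (agenda-pending kind) ⟩
      workload i (agenda kind)
        ≈⟨ workload-agenda started ⟩
      total i kind
        ≲⟨ αq≲βq (Comparison.0≲q comparison) (Comparison.total≲αq comparison) ⟩
      β * load i
        ≈⟨ *-congˡ (≈-sym (delay-self-workload O i refl pending)) ⟩
      β * delay O i i ∎
      where open Job i
    pairwise : ∀ i j → mutualDelay S i j ≲ β * mutualDelay O i j
    pairwise i j with i ≟ j
    -- The double sum includes the diagonal, where both delays are the time spent on the job itself.
    ... | yes refl = begin
      delay S i i + delay S i i
        ≲⟨ +-mono-≲ (self i) (self i) ⟩
      β * delay O i i + β * delay O i i
        ≈⟨ ≈-sym (distribˡ β (delay O i i) (delay O i i)) ⟩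
      β * mutualDelay O i i ∎
    ... | no i≢j with race i≢j (Job.waiting i) (Job.waiting j) run
    ...   | d , r , D≈d = ≲-trans (≈⇒≲ D≈d) (bound
        (race-bounded (Job.started i) (Job.started j) (Job.comparison i) (Job.comparison j) r)
        (workload-≲-mutualDelay O i≢j refl (Job.pending i) refl (Job.pending j)))
      where
      -- The job whose load bounds the mutual delay in `O` depends on `O`, so `d` must be comparable
      -- with both loads.
      bound : ∀ {d} → d ≲ β * load i × d ≲ β * load j →
              (load i ≲ mutualDelay O i j) ⊎ (load j ≲ mutualDelay O i j) →
              d ≲ β * mutualDelay O i j
      bound (d≲βqᵢ , _) (inj₁ qᵢ≲D) = ≲-trans d≲βqᵢ (*-monoˡ-≲ 0≲β qᵢ≲D)
      bound (_ , d≲βqⱼ) (inj₂ qⱼ≲D) = ≲-trans d≲βqⱼ (*-monoˡ-≲ 0≲β qⱼ≲D)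

corollary8 : CompetitiveRatioAtMost (PCP φ β*) β* ×
    β* ≤ fromℚ (+ 2316513 / 1000000) ×
    Σ[ 1≤φ ∈ 1ℝ ≤ φ ] Σ[ 1≤β* ∈ 1ℝ ≤ β* ]
    (∀ α β (1≤α : 1ℝ ≤ α) (1≤β : 1ℝ ≤ β) →
    ratio φ β* 1≤φ 1≤β* ≤ ratio α β 1≤α 1≤β)
corollary8 =
  (λ I S pcp O feasible → unwrap (Competitive.pcp-competitive φ β* admissible I S pcp O feasible)) ,
  unwrap β*-upper ,
  unwrap 1≲φ , unwrap (Admissible.1≲β admissible) ,
  -- `β*` separates the two ratios: it is an upper bound at the chosen parameters and a lower bound
  -- at all others.
  λ α β 1≤α 1≤β → unwrap (≲-trans
    (ratio-≲ φ β* (unwrap 1≲φ) (unwrap (Admissible.1≲β admissible)) admissible)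
    (≲-ratio α β 1≤α 1≤β))
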